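{- There exists $c>0$ such that for all positive integers $n$, $R(W_{2n+1})\leq 10n+c$.
   Context: For $k\ge 3$, the wheel $W_k$ is the graph on $k+1$ vertices obtained by joining one vertex (the center) to every vertex of a cycle of length $k$. For a graph $H$, the Ramsey number $R(H)$ is the smallest integer $N$ such that every $2$-coloring of the edges of $K_N$ contains a monochromatic copy of $H$. -}

module Defs where

open import Data.Nat using (ℕ; zero; suc; _+_; _*_; _≤_)
open import Data.Fin using (Fin; zero; suc; toℕ)
open import Data.Nat.DivMod using (_%_)
open import Data.Fin using (fromℕ<)
open import Data.Nat.DivMod using (m%n<n)
open import Data.Bool using (Bool)
open import Data.Product using (Σ; _×_; ∃)
open import Relation.Binary.PropositionalEquality using (_≡_; _≢_)
open import Function.Definitions using (Injective)

-- A finite graph on vertex set Fin v, given by its adjacency relation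
-- (for the wheels below it is symmetric and irreflexive).
record Graph : Set₁ where
  field
    v    : ℕ
    Adj  : Fin v → Fin v → Set

-- A red/blue (Bool) colouring of the edges of K_N: a symmetric function on
-- pairs; the values on the diagonal are irrelevant.
record Colouring (N : ℕ) : Set where
  field
    col : Fin N → Fin N → Bool
    col-sym : ∀ x y → col x y ≡ col y x

MonoCopy : (H : Graph) {N : ℕ} → Colouring N → Set
MonoCopy H {N} c =
  Σ Bool λ b → Σ (Fin (Graph.v H) → Fin N) λ f →
    Injective _≡_ _≡_ f ×
    (∀ x y → Graph.Adj H x y → Colouring.col c (f x) (f y) ≡ b)

Arrows : ℕ → Graph → Set
Arrows N H = (c : Colouring N) → MonoCopy H c

-- R(H) ≤ M.  Since the arrow property is monotone in N, the least N with
-- N → H is at most M exactly when M → H.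
RamseyLe : Graph → ℕ → Set
RamseyLe H M = Arrows M H

next : {k : ℕ} → Fin (suc k) → Fin (suc k)
next {k} i = fromℕ< (m%n<n (suc (toℕ i)) (suc k))

data WAdj (k : ℕ) : Fin (suc (suc k)) → Fin (suc (suc k)) → Set where
  hub   : ∀ i → WAdj k zero (suc i)
  hub'  : ∀ i → WAdj k (suc i) zero
  rim   : ∀ i → WAdj k (suc i) (suc (next i))
  rim'  : ∀ i → WAdj k (suc (next i)) (suc i)

-- W_k for k = suc k' (used only with k ≥ 3).
Wheel : (k : ℕ) → Graph
Wheel zero    = record { v = 1 ; Adj = λ _ _ → Data.Empty.⊥ }
  where import Data.Empty
Wheel (suc k) = record { v = suc (suc k) ; Adj = WAdj k }

-- Let k = 2 n + 1 and suppose that a colouring of K_N, N = 5 k + O(1), has no monochromatic W_k.  Then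
-- for each vertex v the red graph on the red neighbourhood of v and the blue graph on the blue
-- neighbourhood have no cycle of length k, and no independent set of size k + 1.  Goodman's count of
-- monochromatic triangles gives a v with r red and b blue neighbours, for which these two graphs have
-- together at least (r + b)² - 3 r b - O(r + b) ordered edges.  On the other hand, a graph on m vertices
-- without C_k has at most max (2 k m, m²) / 2 + O(m) ordered edges: if it has no cycle of length at least
-- k by Erdős–Gallai, otherwise by Bondy's pancyclicity argument on a longest cycle.  Since
-- r + b ≥ 5 k, this is a contradiction up to the linear terms, which matter only if both r and b are
-- about 5 k / 2.  For the larger neighbourhood, m ≥ 5 k / 2, the bound improves to (m² - 9 m) / 2: otherwise
-- removing vertices of small degree leaves a graph all of whose degrees are almost m / 2.  If it has
-- a triangle, odd cycles can be lengthened by two up to length k; if not, a neighbourhood is a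
-- large independent set.

module Submission where

open import Defs
open import Data.Bool using (Bool; true; false; _∧_; _∨_; not)
import Data.Bool as Bool
open import Data.Empty using (⊥; ⊥-elim)
open import Data.Fin using (Fin; zero; suc; toℕ)
import Data.Fin.Properties as Fin
open import Data.List using (List; []; _∷_; _++_; length)
open import Data.List.Relation.Unary.All as All using (All; []; _∷_)
import Data.List.Properties
import Data.List.Relation.Unary.All.Properties as All
open import Data.List.Relation.Unary.AllPairs as AllPairs using ([]; _∷_)
import Data.List.Relation.Unary.AllPairs.Properties as AllPairs
open import Data.List.Relation.Unary.Unique.Propositional using (Unique)
open import Data.Nat
open import Data.Nat.DivMod
open import Data.Nat.Properties
open import Data.Nat.Tactic.RingSolver using (solve-∀)
open import Data.Product using (Σ; _×_; _,_; proj₁; proj₂; ∃; ∃₂)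
open import Data.Sum using (_⊎_; inj₁; inj₂)
open import Function using (_∘_; const; case_of_)
open import Relation.Binary.PropositionalEquality
open import Relation.Binary.Definitions using (tri<; tri≈; tri>)
open import Relation.Nullary
open import Relation.Nullary.Decidable using (map′; ¬?; decidable-stable; isYes; _×-dec_; _⊎-dec_; ¬¬-excluded-middle)
open import Algebra.Properties.Semiring.Sum +-*-semiring
  using (sum; sum-cong-≗; ∑-distrib-+; ∑-comm; *-distribˡ-sum; *-distribʳ-sum)


-- The balanced complete bipartite graph has m² / 2 ordered edges and no odd cycle, so bounds on
-- edges alone cannot finish. With m² / 2 + 2 m in both neighbourhoods, Goodman's inequality becomes
-- (r - b)² ≤ 6 (r + b), which a larger additive constant does not refute. What excludes the
-- bipartite graph is the independence number: its halves have at least about 5 k / 4 vertices.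
--
-- The constants are found backwards from the last inequality. After doubling, each edge bound loses
-- 4 m and Goodman's count loses 2 (r + b); with a gain of g r in the larger neighbourhood there
-- remains (r - b)² ≤ (2 - g) r + 6 b, and g = 9 is the least integer for which this fails whenever
-- 0 < r and b ≤ r. The gain 9 m leads to the degree threshold T = 64 in the peeling, which needs m
-- ≥ 30 T + 40 = 1960; twice this, rounded up, is 4000.
--
-- Longest paths, longest cycles and case distinctions on the existence of cycles are available only
-- up to double negation. This suffices, as they serve to prove decidable inequalities or ⊥.

-- A linear inequality X ≤ Y is derived from A ≤ B (a sum of multiples of hypotheses) by a
-- semiring identity with slack s.
farkas : ∀ {A B X Y} s → A ≤ B → Y + A ≡ X + B + s → X ≤ Y
farkas {A} {B} {X} {Y} s A≤B eq = +-cancelʳ-≤ B X Y (begin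
  X + B      ≤⟨ m≤m+n (X + B) s ⟩
  X + B + s  ≡⟨ eq ⟨
  Y + A      ≤⟨ +-monoʳ-≤ Y A≤B ⟩
  Y + B      ∎)
  where open ≤-Reasoning

-- As long as `n` is not maximal, a larger witness replaces it, and `d` bounds the number of
-- replacements. Since `P` need not be decidable, this happens under a double negation.
maximum : (P : ℕ → Set) (M : ℕ) → (∀ n → P n → n ≤ M) → ∀ {n} → P n →
          ¬ ¬ (∃ λ n → P n × ∀ n′ → P n′ → n′ ≤ n)
maximum P M bound {n} Pn = go (M ∸ n) n Pn (≤-reflexive (sym (m+[n∸m]≡n (bound n Pn))))
  where
  go : ∀ d n → P n → M ≤ n + d → ¬ ¬ (∃ λ n → P n × ∀ n′ → P n′ → n′ ≤ n)
  go zero n Pn M≤ ¬max = ¬max (n , Pn , λ n′ Pn′ →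
    ≤-trans (bound n′ Pn′) (≤-trans M≤ (≤-reflexive (+-identityʳ n))))
  go (suc d) n Pn M≤ ¬max = ¬max (n , Pn , λ n′ Pn′ → ≮⇒≥ λ n<n′ →
    go d n′ Pn′ (≤-trans M≤ (≤-trans (≤-reflexive (+-suc n d)) (+-monoˡ-≤ d n<n′))) ¬max)

-- Indicators and finite sums.

ι : Bool → ℕ
ι true  = 1
ι false = 0

ι≤1 : ∀ b → ι b ≤ 1
ι≤1 true  = ≤-refl
ι≤1 false = z≤n

ι-mono : ∀ {a b} → (a ≡ true → b ≡ true) → ι a ≤ ι b
ι-mono {false} f = z≤n
ι-mono {true} {b} f rewrite f refl = ≤-refl

true≢false : ∀ {b} → b ≡ true → b ≡ false → ⊥
true≢false refl ()

≢true : ∀ {b} → b ≢ true → b ≡ false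
≢true {true}  b≢ = ⊥-elim (b≢ refl)
≢true {false} b≢ = refl

single : ∀ {n} → Fin n → Fin n → Bool
single a x = isYes (a Fin.≟ x)

single-refl : ∀ {n} (a : Fin n) → single a a ≡ true
single-refl a with a Fin.≟ a
... | yes _  = refl
... | no a≢a = ⊥-elim (a≢a refl)

single-true : ∀ {n} {a x : Fin n} → single a x ≡ true → a ≡ x
single-true {a = a} {x} eq with a Fin.≟ x
... | yes a≡x = a≡x
single-true () | no _

single-false : ∀ {n} {a x : Fin n} → a ≢ x → single a x ≡ false
single-false a≢x = ≢true (a≢x ∘ single-true)

single-suc : ∀ {n} (a x : Fin n) → single (suc a) (suc x) ≡ single a x
single-suc a x with a Fin.≟ x
... | yes _ = refl
... | no  _ = refl

opaque
  ∑ : ∀ {n} → (Fin n → ℕ) → ℕ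
  ∑ = sum

  ∑-cong : ∀ {n} {f g : Fin n → ℕ} → (∀ i → f i ≡ g i) → ∑ f ≡ ∑ g
  ∑-cong = sum-cong-≗

  ∑-+ : ∀ {n} (f g : Fin n → ℕ) → ∑ (λ i → f i + g i) ≡ ∑ f + ∑ g
  ∑-+ = ∑-distrib-+

  ∑-swap : ∀ {m n} (f : Fin m → Fin n → ℕ) → ∑ (λ i → ∑ λ j → f i j) ≡ ∑ (λ j → ∑ λ i → f i j)
  ∑-swap = ∑-comm

  ∑-*ˡ : ∀ {n} c (f : Fin n → ℕ) → c * ∑ f ≡ ∑ (λ i → c * f i)
  ∑-*ˡ c f = *-distribˡ-sum c f

  ∑-*ʳ : ∀ {n} c (f : Fin n → ℕ) → ∑ f * c ≡ ∑ (λ i → f i * c)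
  ∑-*ʳ c f = *-distribʳ-sum c f

  ∑-mono : ∀ {n} {f g : Fin n → ℕ} → (∀ i → f i ≤ g i) → ∑ f ≤ ∑ g
  ∑-mono {zero}  f≤g = z≤n
  ∑-mono {suc n} f≤g = +-mono-≤ (f≤g zero) (∑-mono (f≤g ∘ suc))

  ∑-positive : ∀ {n} (f : Fin n → ℕ) → 0 < ∑ f → ∃ λ i → 0 < f i
  ∑-positive {suc n} f 0<s with f zero in eq
  ... | suc _ = zero , subst (0 <_) (sym eq) z<s
  ... | zero with i , p ← ∑-positive (f ∘ suc) 0<s = suc i , p

  ∑-pigeonhole : ∀ {n} → 0 < n → (f g : Fin n → ℕ) → ∑ f ≤ ∑ g → ∃ λ i → f i ≤ g i
  ∑-pigeonhole {suc n} _ f g Σf≤Σg with Fin.any? (λ i → f i ≤? g i)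
  ... | yes ∃i = ∃i
  ... | no  ∄i = ⊥-elim (<⇒≱ (+-mono-<-≤ (≰⇒> (∄i ∘ (zero ,_)))
                        (∑-mono (λ i → <⇒≤ (≰⇒> (∄i ∘ (suc i ,_)))))) Σf≤Σg)

  ∑-zero : ∀ {n} (f : Fin n → ℕ) → (∀ i → f i ≡ 0) → ∑ f ≡ 0
  ∑-zero {zero}  f f≡0 = refl
  ∑-zero {suc n} f f≡0 = cong₂ _+_ (f≡0 zero) (∑-zero (f ∘ suc) (f≡0 ∘ suc))

  ∑-single : ∀ {n} (a : Fin n) (g : Fin n → ℕ) → ∑ (λ x → ι (single a x) * g x) ≡ g a
  ∑-single zero g =
    trans (cong₂ _+_ (+-identityʳ (g zero)) (∑-zero (λ i → ι (single zero (suc i)) * g (suc i)) λ i → refl))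
          (+-identityʳ (g zero))
  ∑-single (suc a) g =
    trans (∑-cong λ x → cong (λ b → ι b * g (suc x)) (single-suc a x)) (∑-single a (g ∘ suc))

  range : ℕ → (ℕ → ℕ) → ℕ
  range n f = ∑ {n} (f ∘ toℕ)

  range-zero : ∀ f → range 0 f ≡ 0
  range-zero f = refl

  range-suc : ∀ n f → range (suc n) f ≡ f 0 + range n (f ∘ suc)
  range-suc n f = refl

  range-cong : ∀ n {f g : ℕ → ℕ} → (∀ i → i < n → f i ≡ g i) → range n f ≡ range n g
  range-cong n f≡g = ∑-cong λ i → f≡g (toℕ i) (Fin.toℕ<n i)

  range-mono : ∀ n {f g : ℕ → ℕ} → (∀ i → i < n → f i ≤ g i) → range n f ≤ range n g
  range-mono n f≤g = ∑-mono λ i → f≤g (toℕ i) (Fin.toℕ<n i)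

  range-+ : ∀ n (f g : ℕ → ℕ) → range n (λ i → f i + g i) ≡ range n f + range n g
  range-+ n f g = ∑-+ {n} (f ∘ toℕ) (g ∘ toℕ)

  range-split : ∀ a b f → range (a + b) f ≡ range a f + range b (f ∘ (a +_))
  range-split zero    b f = refl
  range-split (suc a) b f = trans (cong (f 0 +_) (range-split a b (f ∘ suc))) (sym (+-assoc (f 0) _ _))

  ∑-const : ∀ n c → ∑ {n} (const c) ≡ n * c
  ∑-const zero    c = refl
  ∑-const (suc n) c = cong (c +_) (∑-const n c)

  range-const : ∀ n c → range n (const c) ≡ n * c
  range-const = ∑-const

  range-≤ : ∀ n c {f} → (∀ i → i < n → f i ≤ c) → range n f ≤ n * c
  range-≤ n c f≤c = ≤-trans (range-mono n f≤c) (≤-reflexive (∑-const n c))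

  range-last : ∀ n f → range (suc n) f ≡ range n f + f n
  range-last zero    f = +-identityʳ (f 0)
  range-last (suc n) f = trans (cong (f 0 +_) (range-last n (f ∘ suc))) (sym (+-assoc (f 0) _ _))

  range-shift : ∀ n f → f n ≡ f 0 → range n (f ∘ suc) ≡ range n f
  range-shift n f fn≡f0 = +-cancelˡ-≡ (f 0) _ _ (begin
    f 0 + range n (f ∘ suc)  ≡⟨ range-last n f ⟩
    range n f + f n          ≡⟨ cong (range n f +_) fn≡f0 ⟩
    range n f + f 0          ≡⟨ +-comm (range n f) (f 0) ⟩
    f 0 + range n f          ∎)
    where open ≡-Reasoning

  range-positive : ∀ n f → 0 < range n f → ∃ λ i → i < n × 0 < f i
  range-positive n f 0<s with i , p ← ∑-positive {n} (f ∘ toℕ) 0<s = toℕ i , Fin.toℕ<n i , p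

  range-two : ∀ n f → (∀ i → f i ≤ 1) → 2 ≤ range n f →
              ∃₂ λ i j → i < j × j < n × 0 < f i × 0 < f j
  range-two (suc n) f f≤1 2≤s with f 0 in eq
  ... | zero with i , j , i<j , j<n , fi , fj ← range-two n (f ∘ suc) (f≤1 ∘ suc) 2≤s =
    suc i , suc j , s<s i<j , s<s j<n , fi , fj
  ... | suc zero with j , j<n , fj ← range-positive n (f ∘ suc) (s≤s⁻¹ 2≤s) =
    0 , suc j , z<s , s<s j<n , subst (0 <_) (sym eq) z<s , fj
  ... | suc (suc _) = case subst (_≤ 1) eq (f≤1 0) of λ { (s≤s ()) }

-- Degrees and edge counts in a finite graph.

module Graphs {N : ℕ} (adj : Fin N → Fin N → Bool)
  (adj-sym : ∀ x y → adj x y ≡ adj y x) (adj-irrefl : ∀ x → adj x x ≡ false)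
  where

  V : Set
  V = Fin N

  VSet : Set
  VSet = V → Bool

  _∈_ : V → VSet → Set
  x ∈ W = W x ≡ true

  _~_ : V → V → Set
  x ~ y = adj x y ≡ true

  _⊆_ : VSet → VSet → Set
  A ⊆ B = ∀ {x} → x ∈ A → x ∈ B

  _∖_ : VSet → VSet → VSet
  (A ∖ B) x = A x ∧ not (B x)

  infix 4 _∈_ _~_ _⊆_
  infixl 6 _∖_

  card : VSet → ℕ
  card W = ∑ (λ x → ι (W x))

  deg : VSet → V → ℕ
  deg W x = ∑ (λ y → ι (W y) * ι (adj x y))

  -- e A B counts ordered pairs, so that e W W is twice the number of edges inside W.
  e : VSet → VSet → ℕ
  e A B = ∑ (λ x → ι (A x) * deg B x)

  ~-sym : ∀ {x y} → x ~ y → y ~ x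
  ~-sym {x} {y} x~y = trans (adj-sym y x) x~y

  ~⇒≢ : ∀ {x y} → x ~ y → x ≢ y
  ~⇒≢ {x} x~x refl = true≢false x~x (adj-irrefl x)

  ∖-∈ : ∀ {A B : VSet} {x} → x ∈ A → B x ≡ false → x ∈ A ∖ B
  ∖-∈ x∈A x∉B rewrite x∈A | x∉B = refl

  ∖-⊆ : ∀ {A B : VSet} → A ∖ B ⊆ A
  ∖-⊆ {A} {x = x} h with A x
  ... | true = refl
  ∖-⊆ () | false

  ∖-∉ : ∀ {A B : VSet} {x} → x ∈ A ∖ B → B x ≡ false
  ∖-∉ {A} {B} {x} h with A x | B x
  ... | true | false = refl
  ∖-∉ () | true | true
  ∖-∉ () | false | _

  weight : VSet → (V → ℕ) → ℕ
  weight W g = ∑ (λ x → ι (W x) * g x)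

  weight-mono : ∀ W {f g : V → ℕ} → (∀ x → x ∈ W → f x ≤ g x) → weight W f ≤ weight W g
  weight-mono W {f} {g} f≤g = ∑-mono pointwise
    where
    pointwise : ∀ x → ι (W x) * f x ≤ ι (W x) * g x
    pointwise x with W x in eq
    ... | true  = +-monoˡ-≤ 0 (f≤g x eq)
    ... | false = z≤n

  weight-const : ∀ W c → weight W (const c) ≡ card W * c
  weight-const W c = sym (∑-*ʳ c (ι ∘ W))

  weight-+ : ∀ W (f g : V → ℕ) → weight W (λ x → f x + g x) ≡ weight W f + weight W g
  weight-+ W f g = trans (∑-cong λ x → *-distribˡ-+ (ι (W x)) (f x) (g x))
                         (∑-+ (λ x → ι (W x) * f x) _)

  weight-* : ∀ W c (f : V → ℕ) → weight W (λ x → c * f x) ≡ c * weight W f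
  weight-* W c f = trans (∑-cong λ x → swap (ι (W x)) c (f x)) (sym (∑-*ˡ c _))
    where
    swap : ∀ a b d → a * (b * d) ≡ b * (a * d)
    swap = solve-∀

  deg-≤-card : ∀ W x → deg W x ≤ card W
  deg-≤-card W x = ∑-mono λ y → ≤-trans (*-monoʳ-≤ (ι (W y)) (ι≤1 (adj x y))) (≤-reflexive (*-identityʳ _))

  e-≤-card² : ∀ W → e W W ≤ card W * card W
  e-≤-card² W = ≤-trans (weight-mono W λ x _ → deg-≤-card W x) (≤-reflexive (weight-const W (card W)))

  e-comm : ∀ A B → e A B ≡ e B A
  e-comm A B = begin
    ∑ (λ x → ι (A x) * deg B x)
      ≡⟨ ∑-cong (λ x → ∑-*ˡ (ι (A x)) _) ⟩
    ∑ (λ x → ∑ λ y → ι (A x) * (ι (B y) * ι (adj x y)))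
      ≡⟨ ∑-swap (λ x y → ι (A x) * (ι (B y) * ι (adj x y))) ⟩
    ∑ (λ y → ∑ λ x → ι (A x) * (ι (B y) * ι (adj x y)))
      ≡⟨ ∑-cong (λ y → ∑-cong λ x → trans
           (cong (λ b → ι (A x) * (ι (B y) * ι b)) (adj-sym x y))
           (swap (ι (A x)) (ι (B y)) (ι (adj y x)))) ⟩
    ∑ (λ y → ∑ λ x → ι (B y) * (ι (A x) * ι (adj y x)))
      ≡⟨ ∑-cong (λ y → ∑-*ˡ (ι (B y)) _) ⟨
    ∑ (λ y → ι (B y) * deg A y) ∎
    where
    open ≡-Reasoning
    swap : ∀ a b c → a * (b * c) ≡ b * (a * c)
    swap = solve-∀

  -- One equation between indicators states covering and disjointness together; summed against a
  -- weight it splits cardinalities, degrees and edge counts.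
  record Splits (W A B : VSet) : Set where
    constructor splits
    field at : ∀ x → ι (W x) ≡ ι (A x) + ι (B x)
  open Splits

  ∖-splits : ∀ {W A} → A ⊆ W → Splits W A (W ∖ A)
  ∖-splits {W} {A} A⊆W = splits pointwise
    where
    pointwise : ∀ x → ι (W x) ≡ ι (A x) + ι ((W ∖ A) x)
    pointwise x with A x in eq
    ... | true  rewrite A⊆W eq = refl
    ... | false with W x
    ...   | true  = refl
    ...   | false = refl

  weight-split : ∀ {W A B} → Splits W A B → ∀ g → weight W g ≡ weight A g + weight B g
  weight-split {W} {A} {B} sp g = trans
    (∑-cong λ x → trans (cong (_* g x) (at sp x)) (*-distribʳ-+ (g x) (ι (A x)) (ι (B x))))
    (∑-+ (λ x → ι (A x) * g x) _)

  card-split : ∀ {W A B} → Splits W A B → card W ≡ card A + card B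
  card-split {W} {A} {B} sp = trans (∑-cong (at sp)) (∑-+ (ι ∘ A) (ι ∘ B))

  deg-split : ∀ {W A B} → Splits W A B → ∀ x → deg W x ≡ deg A x + deg B x
  deg-split sp x = weight-split sp (λ y → ι (adj x y))

  e-split : ∀ {W A B} → Splits W A B → e W W ≡ e A A + e B B + 2 * e B A
  e-split {W} {A} {B} sp = begin
    e W W                                    ≡⟨ weight-split sp (deg W) ⟩
    weight A (deg W) + weight B (deg W)      ≡⟨ cong₂ _+_ (expand A) (expand B) ⟩
    (e A A + e A B) + (e B A + e B B)        ≡⟨ cong (λ z → (e A A + z) + (e B A + e B B)) (e-comm A B) ⟩
    (e A A + e B A) + (e B A + e B B)        ≡⟨ regroup (e A A) (e B A) (e B B) ⟩
    e A A + e B B + 2 * e B A                ∎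
    where
    open ≡-Reasoning
    expand : ∀ U → weight U (deg W) ≡ e U A + e U B
    expand U = trans (∑-cong λ x → cong (ι (U x) *_) (deg-split sp x)) (weight-+ U (deg A) (deg B))
    regroup : ∀ a b c → (a + b) + (b + c) ≡ a + c + 2 * b
    regroup = solve-∀

  single-⊆ : ∀ {W y} → y ∈ W → single y ⊆ W
  single-⊆ {W} y∈W eq = subst (_∈ W) (single-true eq) y∈W

  weight-single : ∀ y g → weight (single y) g ≡ g y
  weight-single = ∑-single

  card-single : ∀ (y : V) → card (single y) ≡ 1
  card-single y = trans (∑-cong λ x → sym (*-identityʳ (ι (single y x)))) (weight-single y (const 1))

  deg-single : ∀ y x → deg (single y) x ≡ ι (adj x y)
  deg-single y x = weight-single y (ι ∘ adj x)

  card-remove : ∀ {W y} → y ∈ W → card W ≡ suc (card (W ∖ single y))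
  card-remove {W} {y} y∈W = trans (card-split {W} {single y} (∖-splits {W} (single-⊆ {W} y∈W)))
                                  (cong (_+ card (W ∖ single y)) (card-single y))

  e-remove : ∀ {W y} → y ∈ W → e W W ≡ e (W ∖ single y) (W ∖ single y) + 2 * deg W y
  e-remove {W} {y} y∈W = begin
    e W W
      ≡⟨ e-split {W} {single y} {R} sp ⟩
    e (single y) (single y) + e R R + 2 * e R (single y)
      ≡⟨ cong₂ _+_ (cong (_+ e R R) (trans (weight-single y (deg (single y))) loop))
           (cong (2 *_) (trans (e-comm R (single y)) (weight-single y (deg R)))) ⟩
    e R R + 2 * deg R y
      ≡⟨ cong (λ z → e R R + 2 * z) (trans (deg-split {W} sp y) (cong (_+ deg R y) loop)) ⟨
    e R R + 2 * deg W y ∎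
    where
    open ≡-Reasoning
    R = W ∖ single y
    sp : Splits W (single y) R
    sp = ∖-splits {W} (single-⊆ {W} y∈W)
    loop : deg (single y) y ≡ 0
    loop = trans (deg-single y y) (cong ι (adj-irrefl y))

  card-mono : ∀ {A B} → A ⊆ B → card A ≤ card B
  card-mono A⊆B = ∑-mono λ x → ι-mono A⊆B

  card-positive : ∀ {W} → 0 < card W → ∃ λ x → x ∈ W
  card-positive {W} 0<c with x , p ← ∑-positive (ι ∘ W) 0<c = x , positive p
    where
    positive : ∀ {b} → 0 < ι b → b ≡ true
    positive {true} _ = refl

  ∈⇒card-positive : ∀ {W x} → x ∈ W → 0 < card W
  ∈⇒card-positive {W} x∈W = subst (0 <_) (sym (card-remove {W} x∈W)) z<s

  card-zero : ∀ {W} → card W ≤ 0 → e W W ≡ 0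
  card-zero {W} c≤0 = n≤0⇒n≡0 (≤-trans (e-≤-card² W) (≤-trans (*-monoʳ-≤ (card W) c≤0) (≤-reflexive (*-zeroʳ (card W)))))

  neighbours : VSet → V → VSet
  neighbours W x y = W y ∧ adj x y

  card-neighbours : ∀ W x → card (neighbours W x) ≡ deg W x
  card-neighbours W x = ∑-cong λ y → ι-∧ (W y) (adj x y)
    where
    ι-∧ : ∀ a b → ι (a ∧ b) ≡ ι a * ι b
    ι-∧ true  b = sym (+-identityʳ (ι b))
    ι-∧ false b = refl

  ∈-neighbours : ∀ {W x y} → y ∈ neighbours W x → y ∈ W × x ~ y
  ∈-neighbours {W} {x} {y} h with W y | adj x y
  ... | true | true = refl , refl
  ∈-neighbours () | true | false
  ∈-neighbours () | false | _

  common-neighbour : ∀ {W x y} → card W < deg W x + deg W y → ∃ λ u → u ∈ W × x ~ u × y ~ u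
  common-neighbour {W} {x} {y} big with Fin.any? (λ u → (W u Bool.≟ true) ×-dec ((adj x u Bool.≟ true) ×-dec (adj y u Bool.≟ true)))
  ... | yes common = common
  ... | no  none   = ⊥-elim (<⇒≱ big (begin
      deg W x + deg W y ≡⟨ weight-+ W (ι ∘ adj x) (ι ∘ adj y) ⟨
      weight W (λ u → ι (adj x u) + ι (adj y u)) ≤⟨ weight-mono W disjoint ⟩
      weight W (const 1) ≡⟨ trans (weight-const W 1) (*-identityʳ _) ⟩
      card W ∎))
    where
    open ≤-Reasoning
    disjoint : ∀ u → u ∈ W → ι (adj x u) + ι (adj y u) ≤ 1
    disjoint u u∈W with adj x u in p | adj y u in q
    ... | true  | true  = ⊥-elim (none (u , u∈W , p , q))
    ... | true  | false = ≤-refl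
    ... | false | true  = ≤-refl
    ... | false | false = z≤n

  image : (ℕ → V) → (ℕ → Bool) → ℕ → VSet
  image p sel zero    x = false
  image p sel (suc n) x = (sel 0 ∧ single (p 0) x) ∨ image (p ∘ suc) (sel ∘ suc) n x

  ∈-image : ∀ p sel n {x} → x ∈ image p sel n → ∃ λ i → i < n × sel i ≡ true × p i ≡ x
  ∈-image p sel (suc n) {x} h with sel 0 in s | single (p 0) x in eq | ∈-image (p ∘ suc) (sel ∘ suc) n {x}
  ... | true  | true  | rec = 0 , z<s , s , single-true eq
  ... | true  | false | rec with i , i<n , t , q ← rec h = suc i , s<s i<n , t , q
  ... | false | _     | rec with i , i<n , t , q ← rec h = suc i , s<s i<n , t , q

  image-∈ : ∀ p sel {n i} → i < n → sel i ≡ true → p i ∈ image p sel n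
  image-∈ p sel {suc n} {zero}  _   s rewrite s | single-refl (p 0) = refl
  image-∈ p sel {suc n} {suc i} i<n s rewrite image-∈ (p ∘ suc) (sel ∘ suc) {n} {i} (s<s⁻¹ i<n) s =
    ∨-true (sel 0 ∧ single (p 0) (p (suc i)))
    where
    ∨-true : ∀ b → b ∨ true ≡ true
    ∨-true true  = refl
    ∨-true false = refl

  Inj : (ℕ → V) → ℕ → Set
  Inj p n = ∀ {i j} → i < j → j < n → p i ≢ p j

  weight-image : ∀ p sel n → Inj p n → ∀ g → weight (image p sel n) g ≡ range n (λ i → ι (sel i) * g (p i))
  weight-image p sel zero    inj g = trans (∑-zero {N} _ λ _ → refl) (sym (range-zero _))
  weight-image p sel (suc n) inj g = trans
    (weight-split (splits {image p sel (suc n)} {λ x → sel 0 ∧ single (p 0) x} {image (p ∘ suc) (sel ∘ suc) n} pointwise) g)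
    (trans (cong₂ _+_ (head (sel 0)) (weight-image (p ∘ suc) (sel ∘ suc) n (λ i<j j<n → inj (s<s i<j) (s<s j<n)) g))
      (sym (range-suc n _)))
    where
    head : ∀ b → weight (λ x → b ∧ single (p 0) x) g ≡ ι b * g (p 0)
    head true  = trans (weight-single (p 0) g) (sym (+-identityʳ _))
    head false = ∑-zero {N} _ λ _ → refl
    pointwise : ∀ x → ι (image p sel (suc n) x) ≡ ι (sel 0 ∧ single (p 0) x) + ι (image (p ∘ suc) (sel ∘ suc) n x)
    pointwise x with sel 0 | single (p 0) x in eq | image (p ∘ suc) (sel ∘ suc) n x in im
    ... | true  | true  | true with i , i<n , _ , q ← ∈-image (p ∘ suc) (sel ∘ suc) n im =
      ⊥-elim (inj z<s (s<s i<n) (trans (single-true eq) (sym q)))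
    ... | true  | true  | false = refl
    ... | true  | false | true  = refl
    ... | true  | false | false = refl
    ... | false | _     | true  = refl
    ... | false | _     | false = refl

  card-image : ∀ p sel n → Inj p n → card (image p sel n) ≡ range n (ι ∘ sel)
  card-image p sel n inj = begin
    card (image p sel n)                  ≡⟨ *-identityʳ _ ⟨
    card (image p sel n) * 1              ≡⟨ weight-const (image p sel n) 1 ⟨
    weight (image p sel n) (const 1)      ≡⟨ weight-image p sel n inj (const 1) ⟩
    range n (λ i → ι (sel i) * 1)         ≡⟨ range-cong n (λ i _ → *-identityʳ (ι (sel i))) ⟩
    range n (ι ∘ sel)                     ∎
    where open ≡-Reasoning

  all : ℕ → Bool
  all _ = true

  card-image-all : ∀ p n → Inj p n → card (image p all n) ≡ n
  card-image-all p n inj = trans (card-image p all n inj) (trans (range-const n 1) (*-identityʳ n))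

  weight-image-all : ∀ p n → Inj p n → ∀ g → weight (image p all n) g ≡ range n (g ∘ p)
  weight-image-all p n inj g = trans (weight-image p all n inj g) (range-cong n λ i _ → +-identityʳ (g (p i)))

  -- Walks and cycles, as lists and as periodic sequences.

  -- xs lists the interior vertices.
  Walk : V → List V → V → Set
  Walk x []       z = x ~ z
  Walk x (y ∷ ys) z = x ~ y × Walk y ys z

  walk-++ : ∀ {x y z} xs {ys} → Walk x xs y → Walk y ys z → Walk x (xs ++ y ∷ ys) z
  walk-++ []       x~y         w = x~y , w
  walk-++ (_ ∷ xs) (x~x′ , w′) w = x~x′ , walk-++ xs w′ w

  -- Lists are easy to concatenate and to search exhaustively (`cycle?`). An edge counts as a cycle
  -- of length 2 here; the lengths that matter later are at least 3.
  record Cycle (W : VSet) (l : ℕ) : Set where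
    constructor cycle
    field
      {start}  : V
      {rest}   : List V
      closed   : Walk start rest start
      distinct : Unique (start ∷ rest)
      inside   : All (_∈ W) (start ∷ rest)
      size     : suc (length rest) ≡ l

  cycle-mono : ∀ {A B l} → A ⊆ B → Cycle A l → Cycle B l
  cycle-mono A⊆B (cycle w u a s) = cycle w u (All.map A⊆B a) s

  -- With a cycle read as an infinite sequence, rotation is a shift of the index (`shift-periodic`),
  -- and arcs may pass the starting point without arithmetic modulo `L`.
  record Periodic (W : VSet) (L : ℕ) (p : ℕ → V) : Set where
    field
      positive : 0 < L
      period   : ∀ i → p (i + L) ≡ p i
      step     : ∀ i → p i ~ p (suc i)
      distinct : ∀ i d → 0 < d → d < L → p i ≢ p (i + d)
      inside   : ∀ i → p i ∈ W

    injective : ∀ {a i j} → a ≤ i → i < j → j < L + a → p i ≢ p j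
    injective {a} {i} {j} a≤i i<j j<L+a = subst (λ z → p i ≢ p z) (m+[n∸m]≡n (<⇒≤ i<j))
      (distinct i (j ∸ i) (m<n⇒0<n∸m i<j)
        (+-cancelˡ-< i (j ∸ i) L (subst (_< i + L) (sym (m+[n∸m]≡n (<⇒≤ i<j)))
          (<-≤-trans j<L+a (≤-trans (+-monoʳ-≤ L a≤i) (≤-reflexive (+-comm L i)))))))

    inj-L : Inj p L
    inj-L {i} {j} i<j j<L = injective z≤n i<j (subst (j <_) (sym (+-identityʳ L)) j<L)

    vertices : VSet
    vertices = image p all L

    size-vertices : card vertices ≡ L
    size-vertices = card-image-all p L inj-L

    vertices-⊆ : vertices ⊆ W
    vertices-⊆ x∈ with i , _ , _ , refl ← ∈-image p all L x∈ = inside i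

    period-% : ∀ i .{{_ : NonZero L}} → p (i % L) ≡ p i
    period-% i = trans (sym (multiple (i / L) (i % L))) (cong p (sym (m≡m%n+[m/n]*n i L)))
      where
      multiple : ∀ q j → p (j + q * L) ≡ p j
      multiple zero    j = cong p (+-identityʳ j)
      multiple (suc q) j = trans (cong p (trans (cong (j +_) (+-comm L (q * L))) (sym (+-assoc j (q * L) L))))
                                 (trans (period (j + q * L)) (multiple q j))

    ∈-vertices : ∀ i → p i ∈ vertices
    ∈-vertices i = subst (_∈ vertices) (period-% i) (image-∈ p all (m%n<n i L) refl)
      where
      instance
        L≢0 : NonZero L
        L≢0 = >-nonZero positive

    off-cycle : ∀ {v} → vertices v ≡ false → ∀ i → v ≢ p i
    off-cycle v∉ i refl = true≢false (∈-vertices i) v∉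

  shift-periodic : ∀ {W L p} a → Periodic W L p → Periodic W L (p ∘ (a +_))
  shift-periodic {W} {L} {p} a P = record
    { positive = positive
    ; period   = λ i → trans (cong p (sym (+-assoc a i L))) (period (a + i))
    ; step     = λ i → subst (λ z → p (a + i) ~ p z) (sym (+-suc a i)) (step (a + i))
    ; distinct = λ i d 0<d d<L → subst (λ z → p (a + i) ≢ p z) (+-assoc a i d) (distinct (a + i) d 0<d d<L)
    ; inside   = λ i → inside (a + i)
    }
    where open Periodic P

  nth : V → List V → ℕ → V
  nth x xs       zero    = x
  nth x []       (suc i) = x
  nth x (y ∷ ys) (suc i) = nth y ys i

  nth-step : ∀ {x z} xs → Walk x xs z → ∀ {i} → i < length xs → nth x xs i ~ nth x xs (suc i)
  nth-step (y ∷ ys) (x~y , w) {zero}  _   = x~y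
  nth-step (y ∷ ys) (x~y , w) {suc i} i<l = nth-step ys w (s<s⁻¹ i<l)

  nth-last : ∀ {x z} xs → Walk x xs z → nth x xs (length xs) ~ z
  nth-last []       x~z     = x~z
  nth-last (y ∷ ys) (_ , w) = nth-last ys w

  nth-All : ∀ {P : V → Set} {x xs} → All P (x ∷ xs) → ∀ i → P (nth x xs i)
  nth-All (px ∷ pxs)      zero    = px
  nth-All (px ∷ [])       (suc i) = px
  nth-All (px ∷ py ∷ pys) (suc i) = nth-All (py ∷ pys) i

  nth-injective : ∀ {x xs} → Unique (x ∷ xs) → Inj (nth x xs) (suc (length xs))
  nth-injective {xs = []}     _             {i} {suc j} i<j (s≤s ())
  nth-injective {xs = y ∷ ys} (x∉ ∷ u) {zero}  {suc j} i<j j<l = nth-All x∉ j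
  nth-injective {xs = y ∷ ys} (x∉ ∷ u) {suc i} {suc j} i<j j<l = nth-injective u (s<s⁻¹ i<j) (s<s⁻¹ j<l)

  periodic : ∀ {W L} → Cycle W L → ∃ (Periodic W L)
  periodic {W} {L} (cycle {x} {xs} closed distinct inside refl) = p , record
    { positive = z<s
    ; period   = λ i → cong (nth x xs) ([m+n]%n≡m%n i L)
    ; step     = step
    ; distinct = dist
    ; inside   = λ i → nth-All inside (i % L)
    }
    where
    p : ℕ → V
    p i = nth x xs (i % L)
    residue : ∀ i d → (i + d) % L ≡ (i % L + d) % L
    residue i d = trans (cong (_% L) (begin
      i + d                          ≡⟨ cong (_+ d) (m≡m%n+[m/n]*n i L) ⟩
      i % L + (i / L) * L + d        ≡⟨ swap (i % L) ((i / L) * L) d ⟩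
      i % L + d + (i / L) * L        ∎)) ([m+kn]%n≡m%n (i % L + d) (i / L) L)
      where
      open ≡-Reasoning
      swap : ∀ a b c → a + b + c ≡ a + c + b
      swap = solve-∀
    step : ∀ i → p i ~ p (suc i)
    step i with m≤n⇒m<n∨m≡n (m%n<n i L)
    ... | inj₁ r<l = subst (λ z → nth x xs (i % L) ~ nth x xs z) (sym next-index) (nth-step xs closed (s<s⁻¹ r<l))
      where
      next-index : suc i % L ≡ suc (i % L)
      next-index = begin
        suc i % L          ≡⟨ cong (_% L) (+-comm 1 i) ⟩
        (i + 1) % L        ≡⟨ residue i 1 ⟩
        (i % L + 1) % L    ≡⟨ cong (_% L) (+-comm (i % L) 1) ⟩
        suc (i % L) % L    ≡⟨ m<n⇒m%n≡m r<l ⟩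
        suc (i % L)        ∎
        where open ≡-Reasoning
    ... | inj₂ r≡l = subst₂ (λ y z → nth x xs y ~ nth x xs z) (sym (suc-injective r≡l)) (sym next-index) (nth-last xs closed)
      where
      next-index : suc i % L ≡ 0
      next-index = begin
        suc i % L          ≡⟨ cong (_% L) (+-comm 1 i) ⟩
        (i + 1) % L        ≡⟨ residue i 1 ⟩
        (i % L + 1) % L    ≡⟨ cong (_% L) (+-comm (i % L) 1) ⟩
        suc (i % L) % L    ≡⟨ cong (_% L) r≡l ⟩
        L % L              ≡⟨ n%n≡0 L ⟩
        0                  ∎
        where open ≡-Reasoning
    dist : ∀ i d → 0 < d → d < L → p i ≢ p (i + d)
    dist i d 0<d d<L eq with i % L + d <? L
    ... | yes r+d<L = nth-injective distinct (m<m+n (i % L) 0<d) r+d<L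
          (trans eq (cong (nth x xs) (trans (residue i d) (m<n⇒m%n≡m r+d<L))))
    -- The second index wraps around to `i % L + d ∸ L`, which is below `i % L` because `d < L`;
    -- injectivity applies with the roles exchanged.
    ... | no  r+d≮L = nth-injective distinct (subst (_< i % L) (sym wrap) below) (m%n<n i L)
          (sym eq)
      where
      L≤ : L ≤ i % L + d
      L≤ = ≮⇒≥ r+d≮L
      below : i % L + d ∸ L < i % L
      below = +-cancelʳ-< L _ _ (subst (_< i % L + L) (sym (m∸n+n≡m L≤)) (+-monoʳ-< (i % L) d<L))
      wrap : (i + d) % L ≡ i % L + d ∸ L
      wrap = begin
        (i + d) % L              ≡⟨ residue i d ⟩
        (i % L + d) % L          ≡⟨ cong (_% L) (m∸n+n≡m L≤) ⟨
        (i % L + d ∸ L + L) % L  ≡⟨ [m+n]%n≡m%n (i % L + d ∸ L) L ⟩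
        (i % L + d ∸ L) % L      ≡⟨ m<n⇒m%n≡m (<-trans below (m%n<n i L)) ⟩
        i % L + d ∸ L            ∎
        where open ≡-Reasoning

  cycle-≤-card : ∀ {W l} → Cycle W l → l ≤ card W
  cycle-≤-card c with p , P ← periodic c = subst (_≤ _) (Periodic.size-vertices P) (card-mono (Periodic.vertices-⊆ P))

  -- Cycles assembled from arcs of a given cycle.

  up : (ℕ → V) → ℕ → ℕ → List V
  up p a zero    = []
  up p a (suc n) = p a ∷ up p (suc a) n

  down : (ℕ → V) → ℕ → ℕ → List V
  down p a zero    = []
  down p a (suc n) = p (n + a) ∷ down p a n

  length-up : ∀ p a n → length (up p a n) ≡ n
  length-up p a zero    = refl
  length-up p a (suc n) = cong suc (length-up p (suc a) n)

  length-down : ∀ p a n → length (down p a n) ≡ n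
  length-down p a zero    = refl
  length-down p a (suc n) = cong suc (length-down p a n)

  All-up : ∀ {P : V → Set} p a n → (∀ i → a ≤ i → i < n + a → P (p i)) → All P (up p a n)
  All-up p a zero    h = []
  All-up p a (suc n) h = h a ≤-refl (s≤s (m≤n+m a n)) ∷
    All-up p (suc a) n (λ i a<i i< → h i (<⇒≤ a<i) (subst (i <_) (+-suc n a) i<))

  All-down : ∀ {P : V → Set} p a n → (∀ i → a ≤ i → i < n + a → P (p i)) → All P (down p a n)
  All-down p a zero    h = []
  All-down p a (suc n) h = h (n + a) (m≤n+m a n) ≤-refl ∷ All-down p a n (λ i a≤i i< → h i a≤i (m<n⇒m<1+n i<))

  Unique-up : ∀ p a n → (∀ i j → a ≤ i → i < j → j < n + a → p i ≢ p j) → Unique (up p a n)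
  Unique-up p a zero    h = []
  Unique-up p a (suc n) h =
    All-up p (suc a) n (λ i a<i i< → h a i ≤-refl a<i (subst (i <_) (+-suc n a) i<)) ∷
    Unique-up p (suc a) n (λ i j a<i i<j j< → h i j (<⇒≤ a<i) i<j (subst (j <_) (+-suc n a) j<))

  Unique-down : ∀ p a n → (∀ i j → a ≤ i → i < j → j < n + a → p i ≢ p j) → Unique (down p a n)
  Unique-down p a zero    h = []
  Unique-down p a (suc n) h =
    All-down p a n (λ i a≤i i< pn≡pi → h i (n + a) a≤i i< ≤-refl (sym pn≡pi)) ∷
    Unique-down p a n (λ i j a≤i i<j j< → h i j a≤i i<j (m<n⇒m<1+n j<))

  walk-up : ∀ p a n {z} → (∀ i → a ≤ i → i < n + a → p i ~ p (suc i)) → p (n + a) ~ z →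
            Walk (p a) (up p (suc a) n) z
  walk-up p a zero    h end = end
  walk-up p a (suc n) {z} h end = h a ≤-refl (s≤s (m≤n+m a n)) ,
    walk-up p (suc a) n (λ i a<i i< → h i (<⇒≤ a<i) (subst (i <_) (+-suc n a) i<))
      (subst (λ i → p i ~ z) (sym (+-suc n a)) end)

  walk-down : ∀ p a n {z} → (∀ i → a ≤ i → i < n + a → p i ~ p (suc i)) → p a ~ z →
              Walk (p (n + a)) (down p a n) z
  walk-down p a zero    h end = end
  walk-down p a (suc n) h end = ~-sym (h (n + a) (m≤n+m a n) ≤-refl) ,
    walk-down p a n (λ i a≤i i< → h i a≤i (m<n⇒m<1+n i<)) end

  walk? : ∀ x xs z → Dec (Walk x xs z)
  walk? x []       z = adj x z Bool.≟ true
  walk? x (y ∷ ys) z = (adj x y Bool.≟ true) ×-dec walk? y ys z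

  list? : ∀ n {P : List V → Set} → (∀ xs → Dec (P xs)) → Dec (∃ λ xs → length xs ≡ n × P xs)
  list? zero    P? = map′ (λ P[] → [] , refl , P[]) (λ { ([] , _ , P[]) → P[] }) (P? [])
  list? (suc n) P? = map′ (λ { (x , xs , len , Pxxs) → x ∷ xs , cong suc len , Pxxs })
                          (λ { (x ∷ xs , len , Pxxs) → x , xs , suc-injective len , Pxxs })
                          (Fin.any? λ x → list? n (λ xs → P? (x ∷ xs)))

  cycle? : ∀ W n → Dec (Cycle W (suc n))
  cycle? W n = map′ (λ { (x , xs , len , w , u , a) → cycle w u a (cong suc len) })
                    (λ { (cycle {x} {xs} w u a len) → x , xs , suc-injective len , w , u , a })
                    (Fin.any? λ x → list? n λ xs →
                      walk? x xs x ×-dec (AllPairs.allPairs? (λ a b → ¬? (a Fin.≟ b)) (x ∷ xs) ×-dec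
                                          All.all? (λ v → W v Bool.≟ true) (x ∷ xs)))

  distinct-members : ∀ n A → n ≤ card A → ∃ λ xs → length xs ≡ n × Unique xs × All (_∈ A) xs
  distinct-members zero    A _   = [] , refl , [] , []
  distinct-members (suc n) A n<A with x , x∈ ← card-positive {A} (≤-<-trans z≤n n<A)
    with xs , len , u , a ← distinct-members n (A ∖ single x) (s≤s⁻¹ (≤-trans n<A (≤-reflexive (card-remove {A} x∈)))) =
    x ∷ xs , cong suc len , All.map x≢ a ∷ u , x∈ ∷ All.map (∖-⊆ {A} {single x}) a
    where
    x≢ : ∀ {y} → y ∈ A ∖ single x → x ≢ y
    x≢ y∈ refl = true≢false (single-refl x) (∖-∉ {A} {single x} y∈)

  module _ {A} (clique : ∀ {x y} → x ∈ A → y ∈ A → x ≢ y → x ~ y) where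

    clique-walk : ∀ {x z} ys → Unique (x ∷ ys) → All (_∈ A) (x ∷ ys) → z ∈ A → All (_≢ z) (x ∷ ys) → Walk x ys z
    clique-walk []       _              (x∈ ∷ _)       z∈ (x≢z ∷ _)  = clique x∈ z∈ x≢z
    clique-walk (y ∷ ys) ((x≢y ∷ _) ∷ u) (x∈ ∷ y∈ ∷ a) z∈ (_ ∷ ≢z) =
      clique x∈ y∈ x≢y , clique-walk ys u (y∈ ∷ a) z∈ ≢z

    clique-cycle : ∀ n → 2 + n ≤ card A → Cycle A (2 + n)
    clique-cycle n n≤A with distinct-members (2 + n) A n≤A
    ... | x ∷ y ∷ ys , len , u@((x≢y ∷ x≢) ∷ u′) , a@(x∈ ∷ y∈ ∷ a′) = cycle
      (clique x∈ y∈ x≢y , clique-walk ys u′ (y∈ ∷ a′) x∈ (All.map (_∘ sym) (x≢y ∷ x≢))) u a len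

  module _ {W : VSet} {L : ℕ} {p : ℕ → V} (P : Periodic W L p) where
    open Periodic P

    Off : V → Set
    Off v = ∀ i → v ≢ p i

    segment-distinct : ∀ a n → n ≤ L → Unique (up p a n)
    segment-distinct a n n≤L = Unique-up p a n λ i j a≤i i<j j< →
      injective a≤i i<j (<-≤-trans j< (+-monoˡ-≤ a n≤L))

    -- The arc from `p a` to `p (n + a)` ends in `p b`, one period later, and the path `x`, `xs` off
    -- the cycle joins its two ends. `insert-one`, `insert-two` and `detour` are instances.
    splice : ∀ {x} xs a b n → Walk x xs (p a) → x ~ p b → n + a ≡ b + L → n < L →
             Unique (x ∷ xs) → All Off (x ∷ xs) → All (_∈ W) (x ∷ xs) → Cycle W (suc (length xs) + suc n)
    splice {x} xs a b n w x~pb n+a≡b+L n<L u off x∷xs⊆W = cycle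
      (walk-++ xs w (walk-up p a n (λ i _ _ → step i)
        (subst (_~ x) (sym (trans (cong p n+a≡b+L) (period b))) (~-sym x~pb))))
      (AllPairs.++⁺ u (segment-distinct a (suc n) n<L) (All.map (λ off-v → All-up p a (suc n) λ i _ _ → off-v i) off))
      (All.++⁺ x∷xs⊆W (All-up p a (suc n) λ i _ _ → inside i))
      (cong suc (trans (Data.List.Properties.length-++ xs) (cong (λ m → length xs + suc m) (length-up p (suc a) n))))

    insert-one : ∀ {u} b → u ∈ W → Off u → u ~ p b → u ~ p (suc b) → Cycle W (1 + L)
    insert-one {u} b u∈W off u~pb u~pb+1 = subst (λ m → Cycle W (suc m)) (suc-pred L {{>-nonZero positive}})
      (splice [] (suc b) b (pred L) u~pb+1 u~pb around (≤-reflexive (suc-pred L {{>-nonZero positive}}))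
        ([] ∷ []) (off ∷ []) (u∈W ∷ []))
      where
      around : pred L + suc b ≡ b + L
      around = trans (+-suc (pred L) b) (trans (cong (_+ b) (suc-pred L {{>-nonZero positive}})) (+-comm L b))

    insert-two : ∀ {u v} b → u ∈ W → v ∈ W → Off u → Off v → u ~ v → u ~ p b → v ~ p (suc b) → Cycle W (2 + L)
    insert-two {u} {v} b u∈W v∈W off-u off-v u~v u~pb v~pb+1 =
      subst (λ m → Cycle W (2 + m)) (suc-pred L {{>-nonZero positive}})
        (splice (v ∷ []) (suc b) b (pred L) (u~v , v~pb+1) u~pb around (≤-reflexive (suc-pred L {{>-nonZero positive}}))
          ((~⇒≢ u~v ∷ []) ∷ [] ∷ []) (off-u ∷ off-v ∷ []) (u∈W ∷ v∈W ∷ []))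
      where
      around : pred L + suc b ≡ b + L
      around = trans (+-suc (pred L) b) (trans (cong (_+ b) (suc-pred L {{>-nonZero positive}})) (+-comm L b))

    -- Three new vertices take the place of the `d - 1` old ones between `p b` and `p (d + b)`: the
    -- cycle gets longer for d ≤ 3, and by exactly two for d = 2.
    detour : ∀ {u x v} b d → 0 < d → d ≤ L → u ∈ W → x ∈ W → v ∈ W → Off u → Off x → Off v →
             u ~ x → x ~ v → u ≢ v → u ~ p b → v ~ p (d + b) → Cycle W (4 + (L ∸ d))
    detour {u} {x} {v} b d 0<d d≤L u∈W x∈W v∈W off-u off-x off-v u~x x~v u≢v u~pb v~pd+b =
      splice (x ∷ v ∷ []) (d + b) b (L ∸ d) (u~x , x~v , v~pd+b) u~pb around (m∸n<m 0<d d≤L)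
        ((~⇒≢ u~x ∷ u≢v ∷ []) ∷ (~⇒≢ x~v ∷ []) ∷ [] ∷ []) (off-u ∷ off-x ∷ off-v ∷ []) (u∈W ∷ x∈W ∷ v∈W ∷ [])
      where
      m∸n<m : ∀ {m n} → 0 < n → n ≤ m → m ∸ n < m
      m∸n<m {suc m} {suc n} _ _ = s≤s (m∸n≤m m n)
      around : L ∸ d + (d + b) ≡ b + L
      around = trans (sym (+-assoc (L ∸ d) d b)) (trans (cong (_+ b) (m∸n+n≡m d≤L)) (+-comm L b))

    -- The new cycle is `u`, `p 1`, ..., `p c`, `v`, `p (suc c)`, ..., `p L`, where `p L` is `p 0`;
    -- for c = L - 1 the last arc is `p 0` alone.
    insert-twice : ∀ {u v} c → 0 < c → c < L → u ∈ W → v ∈ W → Off u → Off v → u ≢ v →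
                   u ~ p 0 → u ~ p 1 → v ~ p c → v ~ p (suc c) → Cycle W (2 + L)
    insert-twice {u} {v} (suc a) _ a+1<L u∈W v∈W off-u off-v u≢v u~p0 u~p1 v~pa+1 v~pa+2 = cycle
      (walk-++ (up p 1 (suc a))
        (u~p1 , walk-up p 1 a (λ i _ _ → step i) (subst (λ m → p m ~ v) (+-comm 1 a) (~-sym v~pa+1)))
        (v~pa+2 , walk-up p (2 + a) b (λ i _ _ → step i)
          (subst (_~ u) (sym (trans (cong p (trans (swap b a) split)) (period 0))) (~-sym u~p0))))
      (All.++⁺ (All-up p 1 (suc a) λ i _ _ → off-u i) (u≢v ∷ All-up p (2 + a) (suc b) λ i _ _ → off-u i) ∷
       AllPairs.++⁺ (segment-distinct 1 (suc a) (<⇒≤ a+1<L))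
         (All-up p (2 + a) (suc b) (λ i _ _ → off-v i) ∷
          segment-distinct (2 + a) (suc b) (≤-trans (s≤s (≤-trans (m≤n+m b a) (n≤1+n _))) (≤-reflexive split)))
         (All-up p 1 (suc a) λ i 1≤i i<a+2 → (λ pi≡v → off-v i (sym pi≡v)) ∷
           All-up p (2 + a) (suc b) λ j a+2≤j j< → injective {1} 1≤i
             (<-≤-trans i<a+2 (≤-trans (≤-reflexive (+-comm (suc a) 1)) a+2≤j))
             (<-≤-trans j< (≤-reflexive (trans (cong suc (swap b a)) (trans (cong suc split) (+-comm 1 L)))))))
      (u∈W ∷ All.++⁺ (All-up p 1 (suc a) λ i _ _ → inside i) (v∈W ∷ All-up p (2 + a) (suc b) λ i _ _ → inside i))
      (begin
        suc (length (up p 1 (suc a) ++ v ∷ up p (2 + a) (suc b)))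
          ≡⟨ cong suc (Data.List.Properties.length-++ (up p 1 (suc a))) ⟩
        suc (length (up p 1 (suc a)) + suc (length (up p (2 + a) (suc b))))
          ≡⟨ cong₂ (λ x y → suc (x + suc y)) (length-up p 1 (suc a)) (length-up p (2 + a) (suc b)) ⟩
        suc (suc a + suc (suc b))
          ≡⟨ cong (2 +_) (trans (+-suc a (suc b)) split′) ⟩
        2 + L ∎)
      where
      open ≡-Reasoning
      b = L ∸ (2 + a)
      split : 2 + a + b ≡ L
      split = m+[n∸m]≡n a+1<L
      split′ : suc (a + suc b) ≡ L
      split′ = trans (cong suc (+-suc a b)) split
      swap : ∀ b a → b + (2 + a) ≡ 2 + a + b
      swap b a = +-comm b (2 + a)

    -- The cycle is `p 0`, `p 1`, and then the arc from `p c` to `p (h + c)`: 2 + (1 + h) vertices.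
    chord-ahead : ∀ h c → 2 ≤ c → h + c < L → p 1 ~ p c → p 0 ~ p (h + c) → Cycle W (3 + h)
    chord-ahead h c 2≤c h+c<L p1~pc p0~ph+c = cycle
      (step 0 , p1~pc , walk-up p c h (λ i _ _ → step i) (~-sym p0~ph+c))
      ((injective z≤n z<s (≤-trans 2≤L (m≤m+n L 0)) ∷ All-up p c (suc h) (λ i c≤i i< → distinct′ z≤n (<-≤-trans z<s (≤-trans 2≤c c≤i)) i<)) ∷
       (All-up p c (suc h) λ i c≤i i< → distinct′ z≤n (≤-trans 2≤c c≤i) i<) ∷
       segment-distinct c (suc h) (≤-trans (s≤s (m≤m+n h c)) h+c<L))
      (inside 0 ∷ inside 1 ∷ All-up p c (suc h) λ i _ _ → inside i)
      (cong (3 +_) (length-up p (suc c) h))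
      where
      2≤L : 2 ≤ L
      2≤L = ≤-trans 2≤c (<⇒≤ (≤-trans (s≤s (m≤n+m c h)) h+c<L))
      distinct′ : ∀ {i j} → 0 ≤ i → i < j → j < suc h + c → p i ≢ p j
      distinct′ _ i<j j< = injective z≤n i<j (≤-trans (≤-trans j< h+c<L) (m≤m+n L 0))

    -- The chords cross. The cycle descends from `p (2 + t)` to `p 1`, jumps to `p c`, ascends to
    -- `p (r + c)`, which is `p 0`, and jumps back: (2 + t) + (1 + r) vertices.
    chord-around : ∀ t r c → r + c ≡ L → 2 + t < c → p 1 ~ p c → p 0 ~ p (2 + t) → Cycle W (3 + (t + r))
    chord-around t r c r+c≡L t+2<c p1~pc p0~pt+2 = cycle
      (walk-++ (down p 1 (suc t))
        (subst (λ m → Walk (p m) (down p 1 (suc t)) (p c)) (+-comm (suc t) 1)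
          (walk-down p 1 (suc t) (λ i _ _ → step i) p1~pc))
        (walk-up p c r (λ i _ _ → step i)
          (subst (_~ p (2 + t)) (sym (trans (cong p r+c≡L) (period 0))) p0~pt+2)))
      (subst (λ m → Unique (p m ∷ down p 1 (suc t) ++ up p c (suc r))) (+-comm (suc t) 1)
        (AllPairs.++⁺ (Unique-down p 1 (2 + t) λ i j 1≤i i<j j< → injective 1≤i i<j (<-≤-trans j< (+-monoˡ-≤ 1 t+2≤L)))
          (segment-distinct c (suc r) (≤-trans (s≤s (m≤m+n r _)) (≤-reflexive (trans (sym (+-suc r _)) (trans (cong (r +_) (suc-pred c {{>-nonZero (≤-<-trans z≤n t+2<c)}})) r+c≡L)))))
          (All-down p 1 (2 + t) λ i 1≤i i< → All-up p c (suc r) λ j c≤j j< →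
            injective {1} 1≤i (<-≤-trans i< (≤-trans (≤-reflexive (+-comm (2 + t) 1)) (≤-trans t+2<c c≤j)))
              (<-≤-trans j< (≤-reflexive (trans (cong suc r+c≡L) (+-comm 1 L)))))))
      (inside (2 + t) ∷ All.++⁺ (All-down p 1 (suc t) λ i _ _ → inside i) (All-up p c (suc r) λ i _ _ → inside i))
      (begin
        suc (length (down p 1 (suc t) ++ up p c (suc r)))
          ≡⟨ cong suc (Data.List.Properties.length-++ (down p 1 (suc t))) ⟩
        suc (length (down p 1 (suc t)) + length (up p c (suc r)))
          ≡⟨ cong₂ (λ x y → suc (x + y)) (length-down p 1 (suc t)) (length-up p c (suc r)) ⟩
        suc (suc t + suc r)
          ≡⟨ cong (2 +_) (+-suc t r) ⟩
        3 + (t + r) ∎)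
      where
      open ≡-Reasoning
      t+2≤L : 2 + t ≤ L
      t+2≤L = ≤-trans (<⇒≤ t+2<c) (≤-trans (m≤n+m c r) (≤-reflexive r+c≡L))

  range-rotate : ∀ L a f → (∀ i → f (i + L) ≡ f i) → range L (f ∘ (a +_)) ≡ range L f
  range-rotate L zero    f per = refl
  range-rotate L (suc a) f per = trans (range-rotate L a (f ∘ suc) (per ∘ suc)) (range-shift L f (per 0))

  exclusive₂ : ∀ a b → (a ≡ true → b ≡ true → ⊥) → ι a + ι b ≤ 1
  exclusive₂ true  true  a#b = ⊥-elim (a#b refl refl)
  exclusive₂ true  false a#b = ≤-refl
  exclusive₂ false true  a#b = ≤-refl
  exclusive₂ false false a#b = z≤n

  deg-≤ : ∀ {A B x} → (∀ {y} → y ∈ A → x ~ y → y ∈ B) → deg A x ≤ card B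
  deg-≤ {A} {B} {x} nbrs = ∑-mono pointwise
    where
    pointwise : ∀ y → ι (A y) * ι (adj x y) ≤ ι (B y)
    pointwise y with A y in y∈A | adj x y in x~y
    ... | false | _     = z≤n
    ... | true  | false = z≤n
    ... | true  | true  rewrite nbrs y∈A x~y = ≤-refl

  deg-≡ : ∀ {A B x} → B ⊆ A → (∀ {y} → y ∈ A → x ~ y → y ∈ B) → deg A x ≡ deg B x
  deg-≡ {A} {B} {x} B⊆A nbrs = ∑-cong pointwise
    where
    pointwise : ∀ y → ι (A y) * ι (adj x y) ≡ ι (B y) * ι (adj x y)
    pointwise y with A y in a | B y in b | adj x y in x~y
    ... | true  | true  | _     = refl
    ... | false | false | _     = refl
    ... | true  | false | false = refl
    ... | false | true  | false = refl
    ... | true  | false | true  = ⊥-elim (true≢false (nbrs a x~y) b)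
    ... | false | true  | true  = ⊥-elim (true≢false (B⊆A b) a)

  -- Longest paths and the Erdős-Gallai bound.

  -- The path q 0, …, q t has t edges and t + 1 vertices.
  record Path (W : VSet) (t : ℕ) (q : ℕ → V) : Set where
    field
      step     : ∀ {i} → i < t → q i ~ q (suc i)
      distinct : Inj q (suc t)
      inside   : ∀ {i} → i ≤ t → q i ∈ W

  path-length : ∀ {W t q} → Path W t q → suc t ≤ card W
  path-length {W} {t} {q} Q = subst (_≤ card W) (card-image-all q (suc t) distinct) (card-mono within)
    where
    open Path Q
    within : image q all (suc t) ⊆ W
    within x∈ with i , i≤t , _ , refl ← ∈-image q all (suc t) x∈ = inside (s≤s⁻¹ i≤t)

  extend : ∀ {W t q y} → Path W t q → y ∈ W → q 0 ~ y → image q all (suc t) y ≡ false → ∃ (Path W (suc t))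
  extend {W} {t} {q} {y} Q y∈W q0~y y∉ = r , record
    { step     = λ { {zero} _ → ~-sym q0~y ; {suc i} i<t → step (s<s⁻¹ i<t) }
    ; distinct = λ { {zero} {suc j} _ j≤t y≡qj →
                       true≢false (subst (_∈ image q all (suc t)) (sym y≡qj) (image-∈ q all (s<s⁻¹ j≤t) refl)) y∉
                   ; {suc i} {suc j} i<j j≤t → distinct (s<s⁻¹ i<j) (s<s⁻¹ j≤t) }
    ; inside   = λ { {zero} _ → y∈W ; {suc i} i≤t → inside (s≤s⁻¹ i≤t) }
    }
    where
    open Path Q
    r : ℕ → V
    r zero    = y
    r (suc i) = q i

  -- The path q j, q (j - 1), …, q 0, q (j + 1), …, q t.
  rotate : (ℕ → V) → ℕ → ℕ → V
  rotate q j i with i ≤? j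
  ... | yes _ = q (j ∸ i)
  ... | no  _ = q i

  rotate-≤ : ∀ q {i j} → i ≤ j → rotate q j i ≡ q (j ∸ i)
  rotate-≤ q {i} {j} i≤j with i ≤? j
  ... | yes _   = refl
  ... | no  i≰j = ⊥-elim (i≰j i≤j)

  rotate-> : ∀ q {i j} → j < i → rotate q j i ≡ q i
  rotate-> q {i} {j} j<i with i ≤? j
  ... | yes i≤j = ⊥-elim (<⇒≱ j<i i≤j)
  ... | no  _   = refl

  rotate-path : ∀ {W t q j} → Path W t q → j < t → q 0 ~ q (suc j) → Path W t (rotate q j)
  rotate-path {W} {t} {q} {j} Q j<t q0~qj+1 = record { step = step′ ; distinct = distinct′ ; inside = inside′ }
    where
    open Path Q
    step′ : ∀ {i} → i < t → rotate q j i ~ rotate q j (suc i)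
    step′ {i} i<t with <-cmp i j
    ... | tri< i<j _ _ = subst₂ _~_ (sym (trans (rotate-≤ q (<⇒≤ i<j)) (cong q (∸-suc i<j)))) (sym (rotate-≤ q i<j))
                           (~-sym (step (<-≤-trans (≤-<-trans (m∸n≤m j (suc i)) j<t) ≤-refl)))
      where
      ∸-suc : ∀ {i j} → i < j → j ∸ i ≡ suc (j ∸ suc i)
      ∸-suc {zero}  {suc j} _   = refl
      ∸-suc {suc i} {suc j} i<j = ∸-suc (s<s⁻¹ i<j)
    ... | tri≈ _ refl _ = subst₂ _~_ (sym (trans (rotate-≤ q {j} {j} ≤-refl) (cong q (n∸n≡0 j)))) (sym (rotate-> q (n<1+n j))) q0~qj+1
    ... | tri> _ _ j<i = subst₂ _~_ (sym (rotate-> q j<i)) (sym (rotate-> q (m<n⇒m<1+n j<i))) (step i<t)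
    distinct′ : Inj (rotate q j) (suc t)
    distinct′ {a} {b} a<b b≤t eq with a ≤? j | b ≤? j
    ... | yes a≤j | yes b≤j = distinct (∸-monoʳ-< a<b b≤j) (s≤s (≤-trans (m∸n≤m j a) (<⇒≤ j<t)))
                                (sym eq)
    ... | yes a≤j | no  b≰j = distinct (≤-<-trans (m∸n≤m j a) (≰⇒> b≰j)) b≤t eq
    ... | no  a≰j | yes b≤j = a≰j (<⇒≤ (<-≤-trans a<b b≤j))
    ... | no  _   | no  _   = distinct a<b b≤t eq
    inside′ : ∀ {i} → i ≤ t → rotate q j i ∈ W
    inside′ {i} i≤t with i ≤? j
    ... | yes _ = inside (≤-trans (m∸n≤m j i) (<⇒≤ j<t))
    ... | no  _ = inside i≤t

  -- Erdős and Gallai.  In a longest path q whose head has the largest degree d, the set X of the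
  -- predecessors of the neighbours of the head has d elements; by rotation each of them is the head of
  -- a longest path, hence has degree at most d and all its neighbours among q 0, …, q h.  So at most
  -- d (h + 1) ordered edges disappear with X.
  module _ {W : VSet} {h t : ℕ} (no-long : ∀ l → 2 + h ≤ l → ¬ Cycle W l)
           (t-max : ∀ t′ → ∃ (Path W t′) → t′ ≤ t) where

    -- A neighbour outside the path would extend it, and a neighbour at an index i > h would close a
    -- cycle of i + 1 ≥ h + 2 vertices.
    head-neighbour : ∀ {q y} → Path W t q → y ∈ W → q 0 ~ y → ∃ λ i → i ≤ h ⊓ t × q i ≡ y
    head-neighbour {q} {y} Q y∈W q0~y with image q all (suc t) y in eq
    ... | false = ⊥-elim (<⇒≱ (n<1+n t) (t-max (suc t) (extend Q y∈W q0~y eq)))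
    ... | true with i , i<t+1 , _ , refl ← ∈-image q all (suc t) eq = i , ⊓-glb (i≤h i (s≤s⁻¹ i<t+1) q0~y) (s≤s⁻¹ i<t+1) , refl
      where
      open Path Q
      i≤h : ∀ i → i ≤ t → q 0 ~ q i → i ≤ h
      i≤h i i≤t q0~qi = ≮⇒≥ λ h<i → no-long (suc i) (s≤s h<i) (cycle
        (walk-up q 0 i (λ m _ m< → step (<-≤-trans m< (≤-trans (≤-reflexive (+-identityʳ i)) i≤t)))
          (subst (λ m → q m ~ q 0) (sym (+-identityʳ i)) (~-sym q0~qi)))
        (Unique-up q 0 (suc i) λ a b _ a<b b< → distinct a<b (<-≤-trans b< (s≤s (≤-trans (≤-reflexive (+-identityʳ i)) i≤t))))
        (All-up q 0 (suc i) λ m _ m< → inside (≤-trans (s≤s⁻¹ m<) (≤-trans (≤-reflexive (+-identityʳ i)) i≤t)))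
        (cong suc (length-up q 1 i)))

    module _ {q} (Q : Path W t q) (deg-max : ∀ q′ → Path W t q′ → deg W (q′ 0) ≤ deg W (q 0)) where
      open Path Q

      n : ℕ
      n = h ⊓ t

      closed : ℕ → Bool
      closed i = adj (q 0) (q (suc i))

      initial predecessors : VSet
      initial      = image q all (suc n)
      predecessors = image q closed n

      initial-inj : Inj q (suc n)
      initial-inj i<j j≤n = distinct i<j (≤-trans j≤n (s≤s (m⊓n≤n h t)))

      card-initial : card initial ≤ suc h
      card-initial = ≤-trans (≤-reflexive (card-image-all q (suc n) initial-inj)) (s≤s (m⊓n≤m h t))

      initial-⊆ : initial ⊆ W
      initial-⊆ x∈ with i , i≤n , _ , refl ← ∈-image q all (suc n) x∈ = inside (≤-trans (s≤s⁻¹ i≤n) (m⊓n≤n h t))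

      predecessors-⊆ : predecessors ⊆ initial
      predecessors-⊆ x∈ with i , i<n , _ , refl ← ∈-image q closed n x∈ = image-∈ q all (m<n⇒m<1+n i<n) refl

      card-predecessors : deg W (q 0) ≡ card predecessors
      card-predecessors = begin
        deg W (q 0)                                      ≡⟨ deg-≡ initial-⊆ nbr ⟩
        deg initial (q 0)                                ≡⟨ weight-image-all q (suc n) initial-inj _ ⟩
        range (suc n) (λ i → ι (adj (q 0) (q i)))        ≡⟨ range-suc n _ ⟩
        ι (adj (q 0) (q 0)) + range n (ι ∘ closed)       ≡⟨ cong (λ b → ι b + range n (ι ∘ closed)) (adj-irrefl (q 0)) ⟩
        range n (ι ∘ closed)                             ≡⟨ card-image q closed n (λ i<j j<n → initial-inj i<j (m<n⇒m<1+n j<n)) ⟨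
        card predecessors                                ∎
        where
        open ≡-Reasoning
        nbr : ∀ {y} → y ∈ W → q 0 ~ y → y ∈ initial
        nbr y∈W q0~y with i , i≤n , refl ← head-neighbour Q y∈W q0~y = image-∈ q all (s≤s i≤n) refl

      -- The first degree is at most the size of `predecessors`, the second at most that of the rest
      -- of `initial`. Their sum is the share of `x` in the ordered edges that disappear with
      -- `predecessors`, as edges leaving this set count twice.
      predecessor-deg : ∀ x → x ∈ predecessors → deg W x + deg (W ∖ predecessors) x ≤ suc h
      predecessor-deg x x∈ with j , j<n , q0~qj+1 , refl ← ∈-image q closed n x∈ = begin
        deg W (q j) + deg (W ∖ predecessors) (q j)
          ≤⟨ +-mono-≤ (subst (λ v → deg W v ≤ deg W (q 0)) (rotate-≤ q z≤n) (deg-max (rotate q j) R)) (deg-≤ nbr) ⟩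
        deg W (q 0) + card (initial ∖ predecessors)
          ≡⟨ cong (_+ card (initial ∖ predecessors)) card-predecessors ⟩
        card predecessors + card (initial ∖ predecessors)
          ≡⟨ card-split (∖-splits {initial} predecessors-⊆) ⟨
        card initial
          ≤⟨ card-initial ⟩
        suc h ∎
        where
        open ≤-Reasoning
        R : Path W t (rotate q j)
        R = rotate-path Q (<-≤-trans j<n (m⊓n≤n h t)) q0~qj+1
        rotated : ∀ i → i ≤ n → rotate q j i ∈ initial
        rotated i i≤n with i ≤? j
        ... | yes _ = image-∈ q all (s≤s (≤-trans (m∸n≤m j i) (<⇒≤ j<n))) refl
        ... | no  _ = image-∈ q all (s≤s i≤n) refl
        nbr : ∀ {y} → y ∈ W ∖ predecessors → q j ~ y → y ∈ initial ∖ predecessors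
        nbr {y} y∈ qj~y with i , i≤n , refl ← head-neighbour R (∖-⊆ {W} {predecessors} y∈) (subst (_~ y) (sym (rotate-≤ q z≤n)) qj~y) =
          ∖-∈ {initial} {predecessors} (rotated i i≤n) (∖-∉ {W} {predecessors} y∈)

      e-drop : e W W ≤ e (W ∖ predecessors) (W ∖ predecessors) + card predecessors * suc h
      e-drop = begin
        e W W                                ≡⟨ e-split sp ⟩
        e X X + e R R + 2 * e R X            ≡⟨ cong (λ z → e X X + e R R + 2 * z) (e-comm R X) ⟩
        e X X + e R R + 2 * e X R            ≡⟨ regroup (e X X) (e R R) (e X R) ⟩
        e R R + (e X X + e X R + e X R)      ≡⟨ cong (λ z → e R R + (z + e X R)) (weight-+ X (deg X) (deg R)) ⟨
        e R R + (weight X (λ x → deg X x + deg R x) + e X R)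
          ≡⟨ cong (e R R +_) (weight-+ X (λ x → deg X x + deg R x) (deg R)) ⟨
        e R R + weight X (λ x → deg X x + deg R x + deg R x)
          ≤⟨ +-monoʳ-≤ (e R R) (weight-mono X λ x x∈X →
               subst (λ d → d + deg R x ≤ suc h) (deg-split sp x) (predecessor-deg x x∈X)) ⟩
        e R R + weight X (const (suc h))     ≡⟨ cong (e R R +_) (weight-const X (suc h)) ⟩
        e R R + card X * suc h               ∎
        where
        open ≤-Reasoning
        X = predecessors
        R = W ∖ X
        sp : Splits W X R
        sp = ∖-splits {W} (λ x∈ → initial-⊆ (predecessors-⊆ x∈))
        regroup : ∀ a b c → a + b + 2 * c ≡ b + (a + c + c)
        regroup = solve-∀

  erdős-gallai : ∀ h s W → card W ≤ s → (∀ l → 2 + h ≤ l → ¬ Cycle W l) → e W W ≤ suc h * card W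
  erdős-gallai h zero    W W≤s no-long = ≤-trans (≤-reflexive (card-zero {W} W≤s)) z≤n
  erdős-gallai h (suc s) W W≤s no-long with 1 ≤? card W
  ... | no  W≱1 = ≤-trans (≤-reflexive (card-zero {W} (s≤s⁻¹ (≰⇒> W≱1)))) z≤n
  ... | yes W≥1 with x , x∈W ← card-positive {W} W≥1 = decidable-stable (e W W ≤? suc h * card W) λ ¬bound →
    maximum (λ t → ∃ (Path W t)) (card W) (λ t (q , Q) → <⇒≤ (path-length Q)) {0} (const x , trivial x∈W)
      λ (t , (q₀ , Q₀) , t-max) →
    maximum (λ d → ∃ λ q → Path W t q × d ≡ deg W (q 0)) (card W) (λ { d (q , _ , refl) → deg-≤-card W (q 0) })
      (q₀ , Q₀ , refl) λ { (_ , (q , Q , refl) , d-max) →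
    ¬bound (bound Q t-max λ q′ Q′ → d-max _ (q′ , Q′ , refl)) }
    where
    trivial : ∀ {x} → x ∈ W → Path W 0 (const x)
    trivial x∈W = record { step = λ () ; distinct = λ { {i} {zero} () _ ; {i} {suc j} _ (s≤s ()) } ; inside = λ _ → x∈W }
    module _ {t q} (Q : Path W t q) (t-max : ∀ t′ → ∃ (Path W t′) → t′ ≤ t)
             (deg-max : ∀ q′ → Path W t q′ → deg W (q′ 0) ≤ deg W (q 0)) where
      X = predecessors no-long t-max Q deg-max
      X⊆W : X ⊆ W
      X⊆W x∈ = initial-⊆ no-long t-max Q deg-max (predecessors-⊆ no-long t-max Q deg-max x∈)
      induct : ∀ R → R ⊆ W → card R < card W → e R R ≤ suc h * card R
      induct R R⊆W R<W = erdős-gallai h s R (s≤s⁻¹ (≤-trans R<W W≤s)) λ l l≥ c → no-long l l≥ (cycle-mono R⊆W c)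
      bound : e W W ≤ suc h * card W
      bound with card X in eq
      ... | suc _ = begin
        e W W                                ≤⟨ e-drop no-long t-max Q deg-max ⟩
        e (W ∖ X) (W ∖ X) + card X * suc h   ≤⟨ +-monoˡ-≤ _ (induct (W ∖ X) (∖-⊆ {W} {X})
                                                  (subst₂ _<_ refl (sym cardW) (m<n+m (card (W ∖ X)) (subst (0 <_) (sym eq) z<s)))) ⟩
        suc h * card (W ∖ X) + card X * suc h ≡⟨ factor (suc h) (card (W ∖ X)) (card X) ⟩
        suc h * (card X + card (W ∖ X))      ≡⟨ cong (suc h *_) cardW ⟨
        suc h * card W                       ∎
        where
        open ≤-Reasoning
        cardW : card W ≡ card X + card (W ∖ X)
        cardW = card-split (∖-splits {W} {X} X⊆W)
        factor : ∀ a b c → a * b + c * a ≡ a * (c + b)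
        factor = solve-∀
      -- Removing `X` would make no progress, but now the head is isolated and is removed alone.
      ... | zero = begin
        e W W                                ≡⟨ e-remove {W} q0∈W ⟩
        e R R + 2 * deg W (q 0)              ≡⟨ cong (λ d → e R R + 2 * d) (trans (card-predecessors no-long t-max Q deg-max) eq) ⟩
        e R R + 0                            ≡⟨ +-identityʳ _ ⟩
        e R R                                ≤⟨ induct R (∖-⊆ {W} {single (q 0)}) (≤-reflexive (sym (card-remove {W} q0∈W))) ⟩
        suc h * card R                       ≤⟨ *-monoʳ-≤ (suc h) (card-mono {R} {W} (∖-⊆ {W} {single (q 0)})) ⟩
        suc h * card W                       ∎
        where
        open ≤-Reasoning
        R = W ∖ single (q 0)
        q0∈W : q 0 ∈ W
        q0∈W = Path.inside Q z≤n

  -- Bondy's argument, and vertices off a longest cycle.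

  exclusive₄ : ∀ a b c d →
    (a ≡ true → b ≡ true → ⊥) → (a ≡ true → c ≡ true → ⊥) → (a ≡ true → d ≡ true → ⊥) →
    (b ≡ true → c ≡ true → ⊥) → (b ≡ true → d ≡ true → ⊥) → (c ≡ true → d ≡ true → ⊥) →
    ι a + ι b + (ι c + ι d) ≤ 1
  exclusive₄ true b c d a#b a#c a#d _ _ _
    rewrite ≢true (a#b refl) | ≢true (a#c refl) | ≢true (a#d refl) = ≤-refl
  exclusive₄ false true c d _ _ _ b#c b#d _
    rewrite ≢true (b#c refl) | ≢true (b#d refl) = ≤-refl
  exclusive₄ false false c d _ _ _ _ _ c#d = exclusive₂ c d c#d

  nbrs : (ℕ → V) → ℕ → V → ℕ
  nbrs p L x = range L (λ i → ι (adj x (p i)))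

  deg-vertices : ∀ {W L p} (P : Periodic W L p) x → deg (Periodic.vertices P) x ≡ nbrs p L x
  deg-vertices {p = p} P x = weight-image-all p _ (Periodic.inj-L P) (ι ∘ adj x)

  -- Bondy.  Let k = 3 + h be smaller than the length 2 + (h + q) of the cycle.  An edge p 0 — p j and an
  -- edge p 1 — p j′ close a cycle of length k if j = j′ + h, and also if j′ = j + q.  So the indices
  -- j = 2, …, 1 + h + q of the possible neighbours of p 0 are matched with those of p 1 such that of
  -- two matched edges at most one is present.
  bondy-pair : ∀ {W p} h q → 2 ≤ q → Periodic W (2 + (h + q)) p → ¬ Cycle W (3 + h) →
               nbrs p (2 + (h + q)) (p 0) + nbrs p (2 + (h + q)) (p 1) ≤ 2 + (h + q)
  bondy-pair {W} {p} h q 2≤q P no-k = begin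
    range L f + range L g
      ≡⟨ cong₂ _+_ (trans (range-two-suc (h + q) f) (cong₂ (λ x y → x + (f 1 + y)) f0 (range-split h q (f ∘ (2 +_)))))
                   (trans (range-two-suc (h + q) g) (cong₂ (λ x y → g 0 + (x + y)) g1
                      (trans (cong (λ m → range m (g ∘ (2 +_))) (+-comm h q)) (range-split q h (g ∘ (2 +_)))))) ⟩
    0 + (f 1 + (range h f₁ + range q f₂)) + (g 0 + (0 + (range q g₁ + range h g₂)))
      ≡⟨ regroup (f 1) (range h f₁) (range q f₂) (g 0) (range q g₁) (range h g₂) ⟩
    f 1 + g 0 + (range h f₁ + range h g₂) + (range q f₂ + range q g₁)
      ≡⟨ cong₂ (λ x y → f 1 + g 0 + x + y) (range-+ h f₁ g₂) (range-+ q f₂ g₁) ⟨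
    f 1 + g 0 + range h (λ i → f₁ i + g₂ i) + range q (λ i → f₂ i + g₁ i)
      -- The edge between `p 0` and `p 1` is seen from both ends and accounts for the 2; every
      -- matched pair contributes at most 1.
      ≤⟨ +-mono-≤ (+-mono-≤ (+-mono-≤ (ι≤1 (adj (p 0) (p 1))) (ι≤1 (adj (p 1) (p 0)))) (range-≤ h 1 around)) (range-≤ q 1 ahead) ⟩
    1 + 1 + h * 1 + q * 1
      ≡⟨ cong₂ (λ x y → 2 + x + y) (*-identityʳ h) (*-identityʳ q) ⟩
    2 + (h + q) ∎
    where
    open ≤-Reasoning
    L = 2 + (h + q)
    f g f₁ f₂ g₁ g₂ : ℕ → ℕ
    f i = ι (adj (p 0) (p i))
    g i = ι (adj (p 1) (p i))
    f₁ = f ∘ (2 +_)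
    f₂ = λ i → f (2 + (h + i))
    g₁ = g ∘ (2 +_)
    g₂ = λ i → g (2 + (q + i))
    f0 : f 0 ≡ 0
    f0 = cong ι (adj-irrefl (p 0))
    g1 : g 1 ≡ 0
    g1 = cong ι (adj-irrefl (p 1))
    range-two-suc : ∀ m f → range (2 + m) f ≡ f 0 + (f 1 + range m (f ∘ (2 +_)))
    range-two-suc m f = trans (range-suc (suc m) f) (cong (f 0 +_) (range-suc m (f ∘ suc)))
    regroup : ∀ a b c d e f → 0 + (a + (b + c)) + (d + (0 + (e + f))) ≡ a + d + (b + f) + (c + e)
    regroup = solve-∀
    around : ∀ t → t < h → f₁ t + g₂ t ≤ 1
    around t t<h = exclusive₂ _ _ λ p0~ p1~ → no-k (subst (λ m → Cycle W (3 + m)) (m+[n∸m]≡n (<⇒≤ t<h))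
      (chord-around P t (h ∸ t) (2 + (q + t)) total (s<s (s<s (m<n+m t (≤-trans z<s 2≤q)))) p1~ p0~))
      where
      swap : ∀ r q t → r + (2 + (q + t)) ≡ 2 + (t + r + q)
      swap = solve-∀
      total : h ∸ t + (2 + (q + t)) ≡ 2 + (h + q)
      total = trans (swap (h ∸ t) q t) (cong (λ m → 2 + (m + q)) (m+[n∸m]≡n (<⇒≤ t<h)))
    ahead : ∀ t → t < q → f₂ t + g₁ t ≤ 1
    ahead t t<q = exclusive₂ _ _ λ p0~ p1~ → no-k (chord-ahead P h (2 + t) (s≤s (s≤s z≤n))
      (subst (_< L) (sym (swap h t)) (s<s (s<s (+-monoʳ-< h t<q)))) p1~ (subst (λ m → p 0 ~ p m) (sym (swap h t)) p0~))
      where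
      swap : ∀ h t → h + (2 + t) ≡ 2 + (h + t)
      swap = solve-∀

  -- A rotation moves any two consecutive vertices to `p 0` and `p 1`, so their degrees inside the
  -- cycle have sum at most `L`. Summing over all `L` consecutive pairs counts each degree twice.
  bondy : ∀ {W L p} h → 3 + h < L → (P : Periodic W L p) → ¬ Cycle W (3 + h) →
          2 * e (Periodic.vertices P) (Periodic.vertices P) ≤ L * L
  bondy {W} {L} {p} h k<L P no-k = begin
    2 * e C C                              ≡⟨ cong (2 *_) (weight-image-all p L inj-L (deg C)) ⟩
    2 * range L D                          ≡⟨ cong (range L D +_) (+-identityʳ (range L D)) ⟩
    range L D + range L D                  ≡⟨ cong (range L D +_) (range-shift L D (cong (deg C) (period 0))) ⟨
    range L D + range L (D ∘ suc)          ≡⟨ range-+ L D (D ∘ suc) ⟨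
    range L (λ i → D i + D (suc i))        ≤⟨ range-≤ L L (λ i _ → pair i) ⟩
    L * L                                  ∎
    where
    open ≤-Reasoning
    open Periodic P
    C = vertices
    D : ℕ → ℕ
    D i = deg C (p i)
    q = L ∸ (2 + h)
    L≡ : L ≡ 2 + (h + q)
    L≡ = sym (m+[n∸m]≡n (<⇒≤ (<-trans (n<1+n (2 + h)) k<L)))
    2≤q : 2 ≤ q
    2≤q = +-cancelˡ-≤ (2 + h) 2 q (≤-trans (≤-reflexive (+-comm (2 + h) 2)) (≤-trans k<L (≤-reflexive L≡)))
    pair : ∀ i → D i + D (suc i) ≤ L
    pair i = begin
      deg C (p i) + deg C (p (suc i))
        ≡⟨ cong₂ (λ x y → deg C (p x) + deg C (p y)) (+-identityʳ i) (+-comm i 1) ⟨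
      deg C (p (i + 0)) + deg C (p (i + 1))
        ≡⟨ cong₂ _+_ (rotated (p (i + 0))) (rotated (p (i + 1))) ⟩
      nbrs (p ∘ (i +_)) L (p (i + 0)) + nbrs (p ∘ (i +_)) L (p (i + 1))
        ≤⟨ subst (λ m → nbrs (p ∘ (i +_)) m (p (i + 0)) + nbrs (p ∘ (i +_)) m (p (i + 1)) ≤ m) (sym L≡)
             (bondy-pair h q 2≤q (subst (λ m → Periodic W m (p ∘ (i +_))) L≡ (shift-periodic i P)) no-k) ⟩
      L ∎
      where
      rotated : ∀ x → deg C x ≡ nbrs (p ∘ (i +_)) L x
      rotated x = trans (deg-vertices P x) (sym (range-rotate L i (λ j → ι (adj x (p j))) λ j → cong (ι ∘ adj x) (period j)))

  module _ {W L p} (P : Periodic W L p) (longest : ∀ l → L < l → ¬ Cycle W l) where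
    open Periodic P

    longest-one : ∀ {u} → u ∈ W → Off P u → 2 * nbrs p L u ≤ L
    longest-one {u} u∈W off = begin
      2 * range L a                     ≡⟨ cong (range L a +_) (+-identityʳ (range L a)) ⟩
      range L a + range L a             ≡⟨ cong (range L a +_) (range-shift L a (cong (ι ∘ adj u) (period 0))) ⟨
      range L a + range L (a ∘ suc)     ≡⟨ range-+ L a (a ∘ suc) ⟨
      range L (λ i → a i + a (suc i))   ≤⟨ range-≤ L 1 (λ i _ → exclusive₂ _ _ λ u~pi u~pi+1 →
                                             longest (1 + L) ≤-refl (insert-one P i u∈W off u~pi u~pi+1)) ⟩
      L * 1                             ≡⟨ *-identityʳ L ⟩
      L                                 ∎
      where
      open ≤-Reasoning
      a : ℕ → ℕ
      a i = ι (adj u (p i))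

    -- For a neighbour p i of u and a neighbour p j of v the difference j - i is not 1, 2 or 3, since the
    -- walk u, x, v could replace the segment between them: so the index sets of the neighbours of u and
    -- of v give four disjoint translates.
    longest-two : ∀ {u x v} → 3 ≤ L → u ∈ W → x ∈ W → v ∈ W → Off P u → Off P x → Off P v →
                  u ~ x → x ~ v → u ≢ v → 2 * (nbrs p L u + nbrs p L v) ≤ L
    longest-two {u} {x} {v} 3≤L u∈W x∈W v∈W off-u off-x off-v u~x x~v u≢v = begin
      2 * (range L a + range L b)
        ≡⟨ regroup (range L a) (range L b) ⟩
      (range L a + range L a) + (range L b + range L b)
        ≡⟨ cong₂ _+_ (cong (range L a +_) (rot 1 u)) (cong₂ _+_ (rot 2 v) (rot 3 v)) ⟨
      (range L a + range L (a ∘ (1 +_))) + (range L (b ∘ (2 +_)) + range L (b ∘ (3 +_)))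
        ≡⟨ cong₂ _+_ (range-+ L a (a ∘ (1 +_))) (range-+ L (b ∘ (2 +_)) (b ∘ (3 +_))) ⟨
      range L (λ i → a i + a (1 + i)) + range L (λ i → b (2 + i) + b (3 + i))
        ≡⟨ range-+ L (λ i → a i + a (1 + i)) (λ i → b (2 + i) + b (3 + i)) ⟨
      range L (λ i → (a i + a (1 + i)) + (b (2 + i) + b (3 + i)))
        ≤⟨ range-≤ L 1 (λ i _ → exclusive₄ _ _ _ _
             (one u∈W off-u i) (far i 2 z<s (s≤s (s≤s z≤n))) (far i 3 z<s ≤-refl)
             (far (1 + i) 1 z<s (s≤s z≤n)) (far (1 + i) 2 z<s (s≤s (s≤s z≤n))) (one v∈W off-v (2 + i))) ⟩
      L * 1
        ≡⟨ *-identityʳ L ⟩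
      L ∎
      where
      open ≤-Reasoning
      a b : ℕ → ℕ
      a i = ι (adj u (p i))
      b i = ι (adj v (p i))
      regroup : ∀ x y → 2 * (x + y) ≡ (x + x) + (y + y)
      regroup = solve-∀
      rot : ∀ d w → range L (λ i → ι (adj w (p (d + i)))) ≡ range L (λ i → ι (adj w (p i)))
      rot d w = range-rotate L d (λ i → ι (adj w (p i))) λ i → cong (ι ∘ adj w) (period i)
      one : ∀ {w} → w ∈ W → Off P w → ∀ i → w ~ p i → w ~ p (suc i) → ⊥
      one w∈W off i w~pi w~pi+1 = longest (1 + L) ≤-refl (insert-one P i w∈W off w~pi w~pi+1)
      far : ∀ i d → 0 < d → d ≤ 3 → u ~ p i → v ~ p (d + i) → ⊥
      far i d 0<d d≤3 u~ v~ = longest (4 + (L ∸ d)) (s≤s (begin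
        L                ≡⟨ m+[n∸m]≡n (≤-trans d≤3 3≤L) ⟨
        d + (L ∸ d)      ≤⟨ +-monoˡ-≤ (L ∸ d) d≤3 ⟩
        3 + (L ∸ d)      ∎)) (detour P i d 0<d (≤-trans d≤3 3≤L) u∈W x∈W v∈W off-u off-x off-v u~x x~v u≢v u~ v~)

  -- The number of edges without a cycle of length k.

  EdgeBound : ℕ → VSet → Set
  EdgeBound k W = 2 * e W W ≤ 2 * (k * card W) + 4 * card W ⊎ 2 * e W W ≤ card W * card W + 4 * card W

  -- The right side grows by 2 u′ + 5 and the left by 4 d ≤ 2 u′ + 4: the linear term pays for
  -- removing a vertex of slightly more than half the possible degree.
  peel-bound : ∀ {e′ u′ d} → 2 * e′ ≤ u′ * u′ + 4 * u′ → 2 * d ≤ suc (suc u′) →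
               2 * (e′ + 2 * d) ≤ suc u′ * suc u′ + 4 * suc u′
  peel-bound {e′} {u′} {d} h₁ h₂ = farkas 1 (+-mono-≤ h₁ (*-monoʳ-≤ 2 h₂)) (identity e′ u′ d)
    where
    identity : ∀ e′ u′ d → suc u′ * suc u′ + 4 * suc u′ + (2 * e′ + 2 * (2 * d)) ≡
               2 * (e′ + 2 * d) + (u′ * u′ + 4 * u′ + 2 * (2 + u′)) + 1
    identity = solve-∀

  -- The trivial bound s² for the rest suffices, as 2 s² ≤ s² + s L, and the edges to the cycle use
  -- only one of the two terms s L of the square.
  small-rest : ∀ {eC eR eRC L s} → 2 * eC ≤ L * L → 4 * eRC ≤ s * L + L → eR ≤ s * s → s ≤ L →
               2 * (eC + eR + 2 * eRC) ≤ (L + s) * (L + s) + 4 * (L + s)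
  small-rest {eC} {eR} {eRC} {L} {s} h₁ h₂ h₃ s≤L =
    farkas (3 * L + 4 * s) (+-mono-≤ (+-mono-≤ h₁ h₂) (+-mono-≤ (*-monoʳ-≤ 2 h₃) (*-monoʳ-≤ s s≤L)))
      (identity eC eR eRC L s)
    where
    identity : ∀ eC eR eRC L s →
      (L + s) * (L + s) + 4 * (L + s) + (2 * eC + 4 * eRC + (2 * eR + s * s)) ≡
      2 * (eC + eR + 2 * eRC) + (L * L + (s * L + L) + (2 * (s * s) + s * L)) + (3 * L + 4 * s)
    identity = solve-∀

  -- For the rest there is an induction hypothesis. In its first case k s is at most L s and at most
  -- s², hence 2 k s ≤ L s + s².
  large-rest : ∀ {k eC eR eRC L s} → 2 * eC ≤ L * L → 4 * eRC ≤ s * L + L → k ≤ L → L ≤ s →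
               2 * eR ≤ 2 * (k * s) + 4 * s ⊎ 2 * eR ≤ s * s + 4 * s →
               2 * (eC + eR + 2 * eRC) ≤ (L + s) * (L + s) + 4 * (L + s)
  large-rest {k} {eC} {eR} {eRC} {L} {s} h₁ h₂ k≤L L≤s (inj₁ h₃) =
    farkas (3 * L) (+-mono-≤ (+-mono-≤ h₁ h₂) (+-mono-≤ h₃ (+-mono-≤ (*-monoˡ-≤ s k≤L) (*-monoˡ-≤ s (≤-trans k≤L L≤s)))))
      (identity k eC eR eRC L s)
    where
    identity : ∀ k eC eR eRC L s →
      (L + s) * (L + s) + 4 * (L + s) + (2 * eC + 4 * eRC + (2 * eR + (k * s + k * s))) ≡
      2 * (eC + eR + 2 * eRC) + (L * L + (s * L + L) + (2 * (k * s) + 4 * s + (L * s + s * s))) + 3 * L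
    identity = solve-∀
  large-rest {k} {eC} {eR} {eRC} {L} {s} h₁ h₂ k≤L L≤s (inj₂ h₃) =
    farkas (L * s + 3 * L) (+-mono-≤ (+-mono-≤ h₁ h₂) h₃) (identity eC eR eRC L s)
    where
    identity : ∀ eC eR eRC L s →
      (L + s) * (L + s) + 4 * (L + s) + (2 * eC + 4 * eRC + 2 * eR) ≡
      2 * (eC + eR + 2 * eRC) + (L * L + (s * L + L) + (s * s + 4 * s)) + (L * s + 3 * L)
    identity = solve-∀

  -- All weights are at most c / 4 but for one, which is at most c / 2.
  weight-but-one : ∀ R c f → (∀ x → x ∈ R → 2 * f x ≤ c) →
                   (∀ x y → x ∈ R → y ∈ R → x ≢ y → 2 * (f x + f y) ≤ c) → 4 * weight R f ≤ card R * c + c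
  weight-but-one R c f one two with Fin.any? (λ x → (R x Bool.≟ true) ×-dec (c <? 4 * f x))
  ... | no  none = begin
    4 * weight R f            ≡⟨ weight-* R 4 f ⟨
    weight R (λ x → 4 * f x)  ≤⟨ weight-mono R (λ x x∈R → ≮⇒≥ λ c< → none (x , x∈R , c<)) ⟩
    weight R (const c)        ≡⟨ weight-const R c ⟩
    card R * c                ≤⟨ m≤m+n _ c ⟩
    card R * c + c            ∎
    where open ≤-Reasoning
  ... | yes (x , x∈R , c<4fx) = begin
    4 * weight R f            ≡⟨ weight-* R 4 f ⟨
    weight R g                ≡⟨ weight-split sp g ⟩
    weight (single x) g + weight R′ g
      ≡⟨ cong (_+ weight R′ g) (weight-single x g) ⟩
    4 * f x + weight R′ g     ≤⟨ +-mono-≤ (double (f x) (one x x∈R)) (weight-mono R′ others) ⟩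
    2 * c + weight R′ (const c) ≡⟨ cong (2 * c +_) (weight-const R′ c) ⟩
    2 * c + card R′ * c       ≡⟨ regroup c (card R′) ⟩
    suc (card R′) * c + c     ≡⟨ cong (λ m → m * c + c) (card-remove {R} x∈R) ⟨
    card R * c + c            ∎
    where
    open ≤-Reasoning
    R′ = R ∖ single x
    g : V → ℕ
    g y = 4 * f y
    sp : Splits R (single x) R′
    sp = ∖-splits {R} (single-⊆ {R} x∈R)
    regroup : ∀ c r → 2 * c + r * c ≡ suc r * c + c
    regroup = solve-∀
    double : ∀ a → 2 * a ≤ c → 4 * a ≤ 2 * c
    double a h = ≤-trans (≤-reflexive (*-assoc 2 2 a)) (*-monoʳ-≤ 2 h)
    -- As 4 f x exceeds `c`, the bound for the pair leaves at most `c` for 4 f y.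
    others : ∀ y → y ∈ R′ → g y ≤ c
    others y y∈ = farkas 0 (+-mono-≤ (<⇒≤ c<4fx) (*-monoʳ-≤ 2 (two x y x∈R (∖-⊆ {R} {single x} y∈) x≢y))) (identity c (f x) (f y))
      where
      x≢y : x ≢ y
      x≢y refl = true≢false (single-refl x) (∖-∉ {R} {single x} y∈)
      identity : ∀ c a b → c + (c + 2 * (2 * (a + b))) ≡ 4 * b + (4 * a + 2 * c) + 0
      identity = solve-∀

  module _ {W L p} (h : ℕ) (P : Periodic W L p) (longest : ∀ l → L < l → ¬ Cycle W l)
           (k<L : 3 + h < L) (no-k : ¬ Cycle W (3 + h))
           (rest-bound : ∀ R → R ⊆ W → card R < card W → EdgeBound (3 + h) R) where
    open Periodic P using (size-vertices; vertices-⊆; off-cycle) renaming (vertices to C)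

    -- Vertices off the cycle are removed while one of them has degree at most (|U| + 1) / 2; the
    -- cycle itself stays. Afterwards each vertex of the rest `R` is adjacent to more than half of
    -- `R`, since at most L / 2 of its neighbours lie on the cycle. So any two have a common
    -- neighbour in `R`, the middle vertex required by `longest-two`, and few edges join `R` to the
    -- cycle.
    around-longest : ∀ n U → card U ≤ n → C ⊆ U → U ⊆ W → 2 * e U U ≤ card U * card U + 4 * card U
    around-longest zero U U≤0 _ _ = ≤-trans (≤-reflexive (cong (2 *_) (card-zero {U} U≤0))) z≤n
    around-longest (suc n) U U≤n C⊆U U⊆W
      with Fin.any? (λ y → ((U ∖ C) y Bool.≟ true) ×-dec (2 * deg U y ≤? suc (card U)))
    ... | yes (y , y∈ , small) = subst₂ (λ m c → 2 * m ≤ c * c + 4 * c) (sym (e-remove {U} y∈U)) (sym c≡)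
            (peel-bound {e U′ U′} {card U′} {deg U y} (around-longest n U′ (s≤s⁻¹ (subst (_≤ suc n) c≡ U≤n)) C⊆U′ (λ x∈ → U⊆W (∖-⊆ {U} {single y} x∈)))
              (subst (λ c → 2 * deg U y ≤ suc c) c≡ small))
      where
      U′ = U ∖ single y
      y∈U : y ∈ U
      y∈U = ∖-⊆ {U} {C} y∈
      c≡ : card U ≡ suc (card U′)
      c≡ = card-remove {U} y∈U
      C⊆U′ : C ⊆ U′
      C⊆U′ {x} x∈C = ∖-∈ {U} {single y} (C⊆U x∈C) (single-false λ y≡x →
        true≢false (subst (_∈ C) (sym y≡x) x∈C) (∖-∉ {U} {C} y∈))
    ... | no none = subst₂ (λ m c → 2 * m ≤ c * c + 4 * c) (sym (e-split sp)) (sym card-U) bound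
      where
      R = U ∖ C
      s = card R
      sp : Splits U C R
      sp = ∖-splits {U} C⊆U
      card-U : card U ≡ L + s
      card-U = trans (card-split sp) (cong (_+ s) size-vertices)
      R⊆W : R ⊆ W
      R⊆W x∈ = U⊆W (∖-⊆ {U} {C} x∈)
      off : ∀ {x} → x ∈ R → Off P x
      off x∈ = off-cycle (∖-∉ {U} {C} x∈)
      one : ∀ x → x ∈ R → 2 * deg C x ≤ L
      one x x∈ = subst (λ d → 2 * d ≤ L) (sym (deg-vertices P x)) (longest-one P longest (R⊆W x∈) (off x∈))
      inner-deg : ∀ x → x ∈ R → suc s < 2 * deg R x
      inner-deg x x∈ = farkas 0 (+-mono-≤ (≰⇒> λ h → none (x , x∈ , h)) (one x x∈))
        (trans (cong (λ m → 2 * deg R x + (suc (suc m) + 2 * deg C x)) card-U)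
          (trans (identity (deg C x) (deg R x) L s) (cong (λ d → suc (suc s) + (2 * d + L) + 0) (sym (deg-split sp x)))))
        where
        identity : ∀ c r L s → 2 * r + (suc (suc (L + s)) + 2 * c) ≡ suc (suc s) + (2 * (c + r) + L) + 0
        identity = solve-∀
      two : ∀ x y → x ∈ R → y ∈ R → x ≢ y → 2 * (deg C x + deg C y) ≤ L
      two x y x∈ y∈ x≢y with common-neighbour {R} {x} {y} (halve (deg R x) (deg R y) (inner-deg x x∈) (inner-deg y y∈))
        where
        halve : ∀ a b → suc s < 2 * a → suc s < 2 * b → s < a + b
        halve a b h₁ h₂ = *-cancelˡ-< 2 s (a + b) (farkas 3 (+-mono-≤ h₁ h₂) (identity a b s))
          where
          identity : ∀ a b s → 2 * (a + b) + (suc (suc s) + suc (suc s)) ≡ suc (2 * s) + (2 * a + 2 * b) + 3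
          identity = solve-∀
      ... | z , z∈ , x~z , y~z = subst₂ (λ a b → 2 * (a + b) ≤ L) (sym (deg-vertices P x)) (sym (deg-vertices P y))
        (longest-two P longest (≤-trans (m≤m+n 3 h) (<⇒≤ k<L)) (R⊆W x∈) (R⊆W z∈) (R⊆W y∈) (off x∈) (off z∈) (off y∈)
          x~z (~-sym y~z) x≢y)
      cross : 4 * e R C ≤ s * L + L
      cross = weight-but-one R L (deg C) one two
      bound : 2 * (e C C + e R R + 2 * e R C) ≤ (L + s) * (L + s) + 4 * (L + s)
      bound with s ≤? L
      ... | yes s≤L = small-rest {e C C} {e R R} {e R C} {L} {s} (bondy h k<L P no-k) cross (e-≤-card² R) s≤L
      ... | no  s≰L = large-rest {3 + h} {e C C} {e R R} {e R C} {L} {s} (bondy h k<L P no-k) cross (<⇒≤ k<L) (<⇒≤ (≰⇒> s≰L))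
        (rest-bound R R⊆W (<-≤-trans (subst (s <_) (sym card-U) (m<n+m s (≤-<-trans z≤n k<L))) (card-mono U⊆W)))

  edge-bound : ∀ h n W → card W ≤ n → ¬ Cycle W (3 + h) → EdgeBound (3 + h) W
  edge-bound h zero    W W≤0 no-k = inj₁ (≤-trans (≤-reflexive (cong (2 *_) (card-zero {W} W≤0))) z≤n)
  edge-bound h (suc n) W W≤n no-k = decidable-stable ((_ ≤? _) ⊎-dec (_ ≤? _)) λ ¬bound →
    ¬¬-excluded-middle {A = ∃ λ l → 3 + h ≤ l × Cycle W l} λ where
      (no none) → ¬bound (inj₁ (no-long-cycle λ l k≤l c → none (l , k≤l , c)))
      (yes (l , k≤l , c)) → maximum (Cycle W) (card W) (λ _ → cycle-≤-card) c λ (L , c′ , L-max) →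
        ¬bound (inj₂ (long-cycle c′ (λ l′ L<l′ c″ → <⇒≱ L<l′ (L-max l′ c″)) (≤-trans k≤l (L-max l c))))
    where
    no-long-cycle : (∀ l → 3 + h ≤ l → ¬ Cycle W l) → 2 * e W W ≤ 2 * ((3 + h) * card W) + 4 * card W
    no-long-cycle none = ≤-trans (*-monoʳ-≤ 2 (≤-trans (erdős-gallai (suc h) (card W) W ≤-refl none)
      (*-monoˡ-≤ (card W) (n≤1+n (2 + h))))) (m≤m+n _ _)
    long-cycle : ∀ {L} → Cycle W L → (∀ l → L < l → ¬ Cycle W l) → 3 + h ≤ L → 2 * e W W ≤ card W * card W + 4 * card W
    long-cycle {L} c longest k≤L with p , P ← periodic c with m≤n⇒m<n∨m≡n k≤L
    ... | inj₂ refl = ⊥-elim (no-k c)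
    ... | inj₁ k<L  = around-longest h P longest k<L no-k
          (λ R R⊆W R<W → edge-bound h n R (s≤s⁻¹ (≤-trans R<W W≤n)) (no-k ∘ cycle-mono R⊆W))
          (card W) W ≤-refl (Periodic.vertices-⊆ P) (λ x∈ → x∈)

  -- Odd cycles under a minimum degree condition.

  exclusive₃ : ∀ a b c → (a ≡ true → b ≡ true → ⊥) → (a ≡ true → c ≡ true → ⊥) → (b ≡ true → c ≡ true → ⊥) →
               ι a + ι b + ι c ≤ 1
  exclusive₃ true  b c a#b a#c b#c rewrite ≢true (a#b refl) | ≢true (a#c refl) = ≤-refl
  exclusive₃ false b c a#b a#c b#c = exclusive₂ b c b#c

  card-remove-≤ : ∀ A w → card A ≤ suc (card (A ∖ single w))
  card-remove-≤ A w = begin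
    card A                                               ≤⟨ ∑-mono pointwise ⟩
    ∑ (λ x → ι (single w x) + ι ((A ∖ single w) x))      ≡⟨ ∑-+ (λ x → ι (single w x)) (λ x → ι ((A ∖ single w) x)) ⟩
    card (single w) + card (A ∖ single w)                ≡⟨ cong (_+ card (A ∖ single w)) (card-single w) ⟩
    suc (card (A ∖ single w))                            ∎
    where
    open ≤-Reasoning
    pointwise : ∀ x → ι (A x) ≤ ι (single w x) + ι ((A ∖ single w) x)
    pointwise x with A x | single w x
    ... | false | _     = z≤n
    ... | true  | true  = ≤-refl
    ... | true  | false = ≤-refl

  -- Two distinct vertices u, v off the cycle, adjacent to p 0 and to p 2 respectively, have no common
  -- neighbour y off the cycle, for u, y, v could replace p 1; and no neighbour y of u or of v off the
  -- cycle is adjacent to p 1.  If few neighbours of u and v lie on the cycle, this leaves no room for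
  -- the neighbours of p 1.  At most one vertex is adjacent to both ends of two edges of the cycle, so
  -- u and v can be chosen with at most half of the cycle as neighbours.
  module _ {W T l p} (P : Periodic W l p) (3≤l : 3 ≤ l) (1≤T : 1 ≤ T)
           (deg-large : ∀ x → x ∈ W → card W ≤ 2 * deg W x + T)
           (l-small : 2 * l + 3 * T + 2 < card W) (no-longer : ¬ Cycle W (2 + l)) where
    open Periodic P renaming (vertices to C)

    outer : VSet
    outer = W ∖ C

    outer-⊆ : outer ⊆ W
    outer-⊆ = ∖-⊆ {W} {C}

    outer-off : ∀ {x} → x ∈ outer → Off P x
    outer-off x∈ = off-cycle (∖-∉ {W} {C} x∈)

    outer-splits : Splits W C outer
    outer-splits = ∖-splits {W} vertices-⊆

    card-outer : card W ≡ l + card outer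
    card-outer = trans (card-split outer-splits) (cong (_+ card outer) size-vertices)

    deg-outer : ∀ x → deg W x ≡ nbrs p l x + deg outer x
    deg-outer x = trans (deg-split outer-splits x) (cong (_+ deg outer x) (deg-vertices P x))

    -- The number of places of the cycle where `w` could be inserted.
    slots : V → ℕ
    slots w = range l (λ i → ι (adj w (p i) ∧ adj w (p (suc i))))

    ∧-true : ∀ {a b} → 0 < ι (a ∧ b) → a ≡ true × b ≡ true
    ∧-true {true} {true} _ = refl , refl

    at-two-slots : ∀ {u v} a b → a < b → b < l → u ∈ outer → v ∈ outer → u ≢ v →
                   u ~ p a → u ~ p (suc a) → v ~ p b → v ~ p (suc b) → ⊥
    at-two-slots {u} {v} a b a<b b<l u∈ v∈ u≢v u~a u~a+1 v~b v~b+1 =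
      no-longer (insert-twice (shift-periodic a P) (b ∸ a) (m<n⇒0<n∸m a<b) (≤-<-trans (m∸n≤m b a) b<l)
        (outer-⊆ u∈) (outer-⊆ v∈) (λ i → outer-off u∈ (a + i)) (λ i → outer-off v∈ (a + i)) u≢v
        (subst (λ i → u ~ p i) (sym (+-identityʳ a)) u~a) (subst (λ i → u ~ p i) (+-comm 1 a) u~a+1)
        (subst (λ i → v ~ p i) (sym b≡) v~b)
        (subst (λ i → v ~ p i) (sym (trans (+-suc a (b ∸ a)) (cong suc b≡))) v~b+1))
      where
      b≡ : a + (b ∸ a) ≡ b
      b≡ = m+[n∸m]≡n (<⇒≤ a<b)

    -- Two places for each of the two vertices allow a choice of different places, and both
    -- insertions together lengthen the cycle by two.
    not-both : ∀ {u v} → u ∈ outer → v ∈ outer → u ≢ v → 2 ≤ slots u → 2 ≤ slots v → ⊥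
    not-both {u} {v} u∈ v∈ u≢v u≥2 v≥2
      with range-two l _ (λ i → ι≤1 _) u≥2 | range-two l _ (λ i → ι≤1 _) v≥2
    ... | i , _ , i<i′ , i′<l , ui , _ | j , j′ , j<j′ , j′<l , vj , vj′ with <-cmp i j
    ... | tri< i<j _ _ = at-two-slots i j i<j (<-trans j<j′ j′<l) u∈ v∈ u≢v
            (proj₁ (∧-true ui)) (proj₂ (∧-true ui)) (proj₁ (∧-true vj)) (proj₂ (∧-true vj))
    ... | tri≈ _ refl _ = at-two-slots i j′ j<j′ j′<l u∈ v∈ u≢v
            (proj₁ (∧-true ui)) (proj₂ (∧-true ui)) (proj₁ (∧-true vj′)) (proj₂ (∧-true vj′))
    ... | tri> _ _ j<i = at-two-slots j i j<i (<-trans i<i′ i′<l) v∈ u∈ (u≢v ∘ sym)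
            (proj₁ (∧-true vj)) (proj₂ (∧-true vj)) (proj₁ (∧-true ui)) (proj₂ (∧-true ui))

    few-slots : ∀ A → A ⊆ outer → 2 ≤ card A → ∃ λ w → w ∈ A × slots w ≤ 1
    few-slots A A⊆ A≥2 with card-positive {A} (<⇒≤ A≥2)
    ... | u , u∈A with card-positive {A ∖ single u} (s≤s⁻¹ (≤-trans A≥2 (card-remove-≤ A u)))
    ... | v , v∈ with slots u ≤? 1
    ... | yes few = u , u∈A , few
    ... | no many with slots v ≤? 1
    ... | yes few = v , ∖-⊆ {A} {single u} v∈ , few
    ... | no many′ = ⊥-elim (not-both (A⊆ u∈A) (A⊆ (∖-⊆ {A} {single u} v∈)) u≢v (≰⇒> many) (≰⇒> many′))
      where
      u≢v : u ≢ v
      u≢v refl = true≢false (single-refl u) (∖-∉ {A} {single u} v∈)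

    few-on-cycle : ∀ w → slots w ≤ 1 → 2 * nbrs p l w ≤ l + 1
    few-on-cycle w few = begin
      2 * range l a                     ≡⟨ cong (range l a +_) (+-identityʳ (range l a)) ⟩
      range l a + range l a             ≡⟨ cong (range l a +_) (range-shift l a (cong (ι ∘ adj w) (period 0))) ⟨
      range l a + range l (a ∘ suc)     ≡⟨ range-+ l a (a ∘ suc) ⟨
      range l (λ i → a i + a (suc i))   ≤⟨ range-mono l (λ i _ → one-more (adj w (p i)) (adj w (p (suc i)))) ⟩
      range l (λ i → 1 + ι (adj w (p i) ∧ adj w (p (suc i))))
                                        ≡⟨ range-+ l (const 1) (λ i → ι (adj w (p i) ∧ adj w (p (suc i)))) ⟩
      range l (const 1) + slots w       ≤⟨ +-mono-≤ (≤-reflexive (trans (range-const l 1) (*-identityʳ l))) few ⟩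
      l + 1                             ∎
      where
      open ≤-Reasoning
      a : ℕ → ℕ
      a i = ι (adj w (p i))
      one-more : ∀ a b → ι a + ι b ≤ 1 + ι (a ∧ b)
      one-more true  b = ≤-refl
      one-more false b = ι≤1 b

    nbrs-≤ : ∀ x → nbrs p l x ≤ l
    nbrs-≤ x = ≤-trans (range-≤ l 1 λ i _ → ι≤1 _) (≤-reflexive (*-identityʳ l))

    -- Three, because `few-slots` selects from two candidates, and at `p 2` the vertex already
    -- selected at `p 0` is excluded.
    many-outer : ∀ i → 3 ≤ deg outer (p i)
    many-outer i = *-cancelˡ-< 2 2 _ (farkas 0
        (+-mono-≤ (+-mono-≤ (subst (λ d → card W ≤ 2 * d + T) (deg-outer (p i)) (deg-large (p i) (inside i)))
          (*-monoʳ-≤ 2 (nbrs-≤ (p i)))) (+-mono-≤ l-small (*-monoʳ-≤ 2 1≤T)))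
        (identity (deg outer (p i)) (nbrs p l (p i)) l T (card W)))
      where
      identity : ∀ d n l T m → 2 * d + (m + 2 * n + (suc (2 * l + 3 * T + 2) + 2 * 1)) ≡
                 5 + (2 * (n + d) + T + 2 * l + (m + 2 * T)) + 0
      identity = solve-∀

    -- The origin of `l-small`: the three degree conditions add up to 3 m ≤ 2 (l + 1) + 2 l + 2 (m -
    -- l) + 3 T.
    count : ∀ {m} nu du nv dv n₁ d₁ f → m ≡ l + f → m ≤ 2 * (nu + du) + T → 2 * nu ≤ l + 1 →
              m ≤ 2 * (nv + dv) + T → 2 * nv ≤ l + 1 → m ≤ 2 * (n₁ + d₁) + T → n₁ ≤ l →
              du + dv + d₁ ≤ f → m ≤ 2 * l + 3 * T + 2
    count nu du nv dv n₁ d₁ f refl h₁ h₂ h₃ h₄ h₅ h₆ h₇ =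
      farkas 0 (+-mono-≤ (+-mono-≤ (+-mono-≤ h₁ h₂) (+-mono-≤ h₃ h₄)) (+-mono-≤ (+-mono-≤ h₅ (*-monoʳ-≤ 2 h₆)) (*-monoʳ-≤ 2 h₇)))
        (identity nu du nv dv n₁ d₁ f l T)
      where
      identity : ∀ nu du nv dv n₁ d₁ f l T →
        2 * l + 3 * T + 2 + (l + f + 2 * nu + (l + f + 2 * nv) + (l + f + 2 * n₁ + 2 * (du + dv + d₁))) ≡
        l + f + (2 * (nu + du) + T + (l + 1) + (2 * (nv + dv) + T + (l + 1)) + (2 * (n₁ + d₁) + T + 2 * l + 2 * f)) + 0
      identity = solve-∀

    crowded : ∀ {u v} → u ∈ outer → v ∈ outer → u ≢ v → p 0 ~ u → p 2 ~ v → slots u ≤ 1 → slots v ≤ 1 → ⊥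
    crowded {u} {v} u∈ v∈ u≢v p0~u p2~v few-u few-v = <⇒≱ l-small (count (nbrs p l u) (deg outer u) (nbrs p l v) (deg outer v)
      (nbrs p l (p 1)) (deg outer (p 1)) (card outer) card-outer
      (large u∈W) (few-on-cycle u few-u) (large v∈W) (few-on-cycle v few-v) (large (inside 1)) (nbrs-≤ (p 1)) disjoint)
      where
      u∈W : u ∈ W
      u∈W = outer-⊆ u∈
      v∈W : v ∈ W
      v∈W = outer-⊆ v∈
      large : ∀ {x} → x ∈ W → card W ≤ 2 * (nbrs p l x + deg outer x) + T
      large {x} x∈W = subst (λ d → card W ≤ 2 * d + T) (deg-outer x) (deg-large x x∈W)
      apart : ∀ y → y ∈ outer → ι (adj u y) + ι (adj v y) + ι (adj (p 1) y) ≤ 1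
      apart y y∈ = exclusive₃ _ _ _
        (λ u~y v~y → no-longer (subst (λ m → Cycle W (2 + m)) (m+[n∸m]≡n (<⇒≤ 3≤l))
          (detour P 0 2 z<s (<⇒≤ 3≤l) u∈W (outer-⊆ y∈) v∈W (outer-off u∈) (outer-off y∈) (outer-off v∈)
            u~y (~-sym v~y) u≢v (~-sym p0~u) (~-sym p2~v))))
        (λ u~y p1~y → no-longer
          (insert-two P 0 u∈W (outer-⊆ y∈) (outer-off u∈) (outer-off y∈) u~y (~-sym p0~u) (~-sym p1~y)))
        (λ v~y p1~y → no-longer
          (insert-two P 1 (outer-⊆ y∈) v∈W (outer-off y∈) (outer-off v∈) (~-sym v~y) (~-sym p1~y) (~-sym p2~v)))
      disjoint : deg outer u + deg outer v + deg outer (p 1) ≤ card outer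
      disjoint = begin
        deg outer u + deg outer v + deg outer (p 1)
          ≡⟨ cong (_+ deg outer (p 1)) (weight-+ outer (ι ∘ adj u) (ι ∘ adj v)) ⟨
        weight outer (λ y → ι (adj u y) + ι (adj v y)) + deg outer (p 1)
          ≡⟨ weight-+ outer (λ y → ι (adj u y) + ι (adj v y)) (ι ∘ adj (p 1)) ⟨
        weight outer (λ y → ι (adj u y) + ι (adj v y) + ι (adj (p 1) y))
          ≤⟨ weight-mono outer apart ⟩
        weight outer (const 1)
          ≡⟨ trans (weight-const outer 1) (*-identityʳ _) ⟩
        card outer ∎
        where open ≤-Reasoning

    lengthening : ⊥
    lengthening = pick-second (few-slots (neighbours outer (p 0)) (λ x∈ → proj₁ (∈-neighbours {outer} {p 0} x∈))
      (≤-trans (n≤1+n 2) (subst (3 ≤_) (sym (card-neighbours outer (p 0))) (many-outer 0))))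
      where
      pick-second : ∃ (λ u → u ∈ neighbours outer (p 0) × slots u ≤ 1) → ⊥
      pick-second (u , u∈N , few-u) = finish (few-slots A (λ x∈ → proj₁ (∈-neighbours {outer} {p 2} (A⊆ x∈)))
        (s≤s⁻¹ (≤-trans (subst (3 ≤_) (sym (card-neighbours outer (p 2))) (many-outer 2))
          (card-remove-≤ (neighbours outer (p 2)) u))))
        where
        A : VSet
        A = neighbours outer (p 2) ∖ single u
        A⊆ : A ⊆ neighbours outer (p 2)
        A⊆ = ∖-⊆ {neighbours outer (p 2)} {single u}
        finish : ∃ (λ v → v ∈ A × slots v ≤ 1) → ⊥
        finish (v , v∈A , few-v) = crowded (proj₁ (∈-neighbours {outer} {p 0} u∈N)) (proj₁ (∈-neighbours {outer} {p 2} (A⊆ v∈A)))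
          (λ { refl → true≢false (single-refl u) (∖-∉ {neighbours outer (p 2)} {single u} v∈A) })
          (proj₂ (∈-neighbours {outer} {p 0} u∈N)) (proj₂ (∈-neighbours {outer} {p 2} (A⊆ v∈A))) few-u few-v

  odd-cycle : ∀ {W T} i → 1 ≤ T → (∀ x → x ∈ W → card W ≤ 2 * deg W x + T) →
              2 * (3 + 2 * i) + 3 * T + 2 < card W → Cycle W 3 → ¬ ¬ Cycle W (3 + 2 * i)
  odd-cycle zero    1≤T deg-large small c none = none c
  odd-cycle {W} {T} (suc i) 1≤T deg-large small c none = odd-cycle i 1≤T deg-large small′ c λ c′ →
    lengthening (proj₂ (periodic c′)) (m≤m+n 3 (2 * i)) 1≤T deg-large small′ (none ∘ subst (Cycle W) (grown i))
    where
    small′ : 2 * (3 + 2 * i) + 3 * T + 2 < card W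
    small′ = ≤-<-trans (+-monoˡ-≤ 2 (+-monoˡ-≤ (3 * T) (*-monoʳ-≤ 2 (+-monoʳ-≤ 3 (*-monoʳ-≤ 2 (n≤1+n i)))))) small
    grown : ∀ i → 2 + (3 + 2 * i) ≡ 3 + 2 * suc i
    grown = solve-∀

  Independence≤ : ℕ → VSet → Set
  Independence≤ k W = ∀ I → I ⊆ W → (∀ {x y} → x ∈ I → y ∈ I → adj x y ≡ false) → card I ≤ k

  dense-impossible : ∀ {W T} i → 1 ≤ T → (∀ x → x ∈ W → card W ≤ 2 * deg W x + T) →
                     2 * (3 + 2 * i) + 3 * T + 2 < card W → ¬ Cycle W (3 + 2 * i) → Independence≤ (3 + 2 * i) W → ⊥
  dense-impossible {W} {T} i 1≤T deg-large small no-k indep = ¬¬-excluded-middle {A = Cycle W 3} λ where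
      (yes c) → odd-cycle i 1≤T deg-large small c no-k
      (no triangle-free) → case card-positive {W} (≤-<-trans z≤n small) of λ (x , x∈W) → <⇒≱ small (begin
        card W                          ≤⟨ deg-large x x∈W ⟩
        2 * deg W x + T                 ≡⟨ cong (λ d → 2 * d + T) (card-neighbours W x) ⟨
        2 * card (neighbours W x) + T
          ≤⟨ +-mono-≤ (*-monoʳ-≤ 2 (indep (neighbours W x) (λ y∈ → proj₁ (∈-neighbours {W} {x} y∈))
               λ {y} {z} y∈ z∈ → ≢true λ y~z → triangle-free (triangle x∈W (∈-neighbours {W} {x} y∈) (∈-neighbours {W} {x} z∈) y~z)))
               (m≤m+n T (2 * T)) ⟩
        2 * (3 + 2 * i) + 3 * T         ≤⟨ m≤m+n _ 2 ⟩
        2 * (3 + 2 * i) + 3 * T + 2     ∎)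
    where
    open ≤-Reasoning
    triangle : ∀ {x y z} → x ∈ W → y ∈ W × x ~ y → z ∈ W × x ~ z → y ~ z → Cycle W 3
    triangle x∈W (y∈W , x~y) (z∈W , x~z) y~z = cycle (x~y , y~z , ~-sym x~z)
      ((~⇒≢ x~y ∷ ~⇒≢ x~z ∷ []) ∷ (~⇒≢ y~z ∷ []) ∷ [] ∷ []) (x∈W ∷ y∈W ∷ z∈W ∷ []) refl

  -- Peeling down to a large minimum degree.

  -- While vertices of degree at most (u - T) / 2 are removed, u being the number of vertices that are left,
  -- the excess 2 e + 9 m - u² grows by 2 T - 1 at each step.  By edge-bound it stays at most 4 u + 9 m,
  -- hence at most about a tenth of the m vertices go before all degrees are large.  Here T = suc t.
  module _ (i t : ℕ) (63≤t : 63 ≤ t) (W : VSet) (no-k : ¬ Cycle W (3 + 2 * i)) (indep : Independence≤ (3 + 2 * i) W)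
           (k-small : 5 * (3 + 2 * i) ≤ 2 * card W) (W-large : 10 * (27 * suc t + 35) + 10 ≤ 9 * card W) where

    -- At least 9 m / 10 - 1 vertices are left and 2 k ≤ 4 m / 5. The difference m / 10 - 1 must be
    -- at least 3 T + 3, that is m ≥ 30 T + 40; nine times this is `W-large`.
    peeling-few : ∀ {k u d m} → 5 * k ≤ 2 * m → m ≡ u + d → 9 * d ≤ u + 10 → 10 * (27 * suc t + 35) + 10 ≤ 9 * m →
                  2 * k + 3 * suc t + 2 < u
    peeling-few {k} {u} {d} h₁ refl h₂ h₃ = *-cancelˡ-≤ 90 (farkas 0
      (+-mono-≤ (+-mono-≤ (*-monoʳ-≤ 36 h₁) (*-monoʳ-≤ 9 h₂)) h₃) (identity k u d t))
      where
      identity : ∀ k u d t → 90 * u + (36 * (5 * k) + 9 * (9 * d) + (10 * (27 * suc t + 35) + 10)) ≡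
                 90 * suc (2 * k + 3 * suc t + 2) + (36 * (2 * (u + d)) + 9 * (u + 10) + 9 * (u + d)) + 0
      identity = solve-∀

    -- This gives 2 k u ≤ u², so that throughout the peeling the first alternative of `EdgeBound`
    -- implies the second.
    peeling-2k≤u : ∀ {k u d m} → 0 < k → 5 * k ≤ 2 * m → m ≡ u + d → 9 * d ≤ u + 10 → 2 * k ≤ u
    peeling-2k≤u {k} {u} {d} 0<k h₁ refl h₂ = ≮⇒≥ λ u<2k → <⇒≱ 0<k (*-cancelˡ-≤ 5 (farkas 0
      (+-mono-≤ (+-mono-≤ (*-monoʳ-≤ 9 h₁) (*-monoʳ-≤ 2 h₂)) (*-monoʳ-≤ 20 u<2k)) (identity k u d)))
      where
      identity : ∀ k u d → 5 * 0 + (9 * (5 * k) + 2 * (9 * d) + 20 * suc u) ≡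
                 5 * k + (9 * (2 * (u + d)) + 2 * (u + 10) + 20 * (2 * k)) + 0
      identity = solve-∀

    -- The first three hypotheses leave (2 t - 8) d < 13 u, where 13 = 4 + 9, and 63 is the least
    -- `t` with 2 t - 8 ≥ 9 · 13.
    peeling-9d≤u : ∀ {e u d m} → 2 * e ≤ u * u + 4 * u → m ≡ u + d → u * u + suc (2 * t) * d < 2 * e + 9 * m → 9 * d ≤ u
    peeling-9d≤u {e} {u} {d} h₁ refl h₂ = *-cancelˡ-≤ 13 (farkas (d + 1)
      (+-mono-≤ (+-mono-≤ h₁ h₂) (*-monoʳ-≤ 2 (*-monoˡ-≤ d 63≤t))) (identity e u d t))
      where
      identity : ∀ e u d t → 13 * u + (2 * e + suc (u * u + suc (2 * t) * d) + 2 * (63 * d)) ≡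
                 13 * (9 * d) + (u * u + 4 * u + (2 * e + 9 * (u + d)) + 2 * (t * d)) + (d + 1)
      identity = solve-∀

    -- A removal adds 9 on the left and takes 1 from `u`, hence the 10 in the invariant of
    -- `peeling`; `peeling-9d≤u` recovers the sharper form before the next removal.
    peeling-small : ∀ {u d} → 9 * d ≤ suc u → 9 * suc d ≤ u + 10
    peeling-small {u} {d} h = farkas 0 h (identity u d)
      where
      identity : ∀ u d → u + 10 + 9 * d ≡ 9 * suc d + suc u + 0
      identity = solve-∀

    peeling-excess : ∀ {e u g d m} → suc u * suc u + suc (2 * t) * d < 2 * (e + 2 * g) + 9 * m → 2 * g + suc t ≤ suc u →
                     u * u + suc (2 * t) * suc d < 2 * e + 9 * m
    peeling-excess {e} {u} {g} {d} {m} h₁ h₂ = farkas 0 (+-mono-≤ h₁ (*-monoʳ-≤ 2 h₂)) (identity e u g d m t)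
      where
      identity : ∀ e u g d m t → 2 * e + 9 * m + (suc (suc u * suc u + suc (2 * t) * d) + 2 * (2 * g + suc t)) ≡
                 suc (u * u + suc (2 * t) * suc d) + (2 * (e + 2 * g) + 9 * m + 2 * suc u) + 0
      identity = solve-∀

    peeling : ∀ n U d → card U ≤ n → U ⊆ W → card W ≡ card U + d → 9 * d ≤ card U + 10 →
              card U * card U + suc (2 * t) * d < 2 * e U U + 9 * card W → ⊥
    peeling n U d U≤n U⊆W m≡u+d d-small excess
      with Fin.any? (λ y → (U y Bool.≟ true) ×-dec (2 * deg U y + suc t ≤? card U))
    ... | no none = dense-impossible {U} {suc t} i z<s
            (λ x x∈ → <⇒≤ (≰⇒> λ h → none (x , x∈ , h))) (peeling-few {3 + 2 * i} {card U} {d} k-small m≡u+d d-small W-large)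
            (no-k ∘ cycle-mono U⊆W) (λ I I⊆U → indep I (λ x∈ → U⊆W (I⊆U x∈)))
    peeling zero U d U≤0 _ _ _ _ | yes (y , y∈ , _) = <⇒≱ (∈⇒card-positive {U} y∈) U≤0
    peeling (suc n) U d U≤n U⊆W m≡u+d d-small excess | yes (y , y∈ , low) =
      peeling n U′ (suc d) (s≤s⁻¹ (subst (_≤ suc n) u≡ U≤n)) (λ x∈ → U⊆W (∖-⊆ {U} {single y} x∈))
        (trans m≡u+d (trans (cong (_+ d) u≡) (sym (+-suc (card U′) d))))
        (peeling-small {card U′} {d} (subst (9 * d ≤_) u≡ (peeling-9d≤u {e U U} {card U} {d} upper m≡u+d excess)))
        (peeling-excess {e U′ U′} {card U′} {deg U y} {d} {card W} (subst₂ (λ u e → u * u + suc (2 * t) * d < 2 * e + 9 * card W) u≡ (e-remove {U} y∈) excess)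
          (subst (2 * deg U y + suc t ≤_) u≡ low))
      where
      U′ = U ∖ single y
      u≡ : card U ≡ suc (card U′)
      u≡ = card-remove {U} y∈
      upper : 2 * e U U ≤ card U * card U + 4 * card U
      upper with edge-bound (2 * i) (card U) U ≤-refl (no-k ∘ cycle-mono U⊆W)
      ... | inj₂ h = h
      ... | inj₁ h = ≤-trans h (+-monoˡ-≤ (4 * card U)
        (≤-trans (≤-reflexive (sym (*-assoc 2 (3 + 2 * i) (card U))))
                 (*-monoˡ-≤ (card U) (peeling-2k≤u {3 + 2 * i} {card U} {d} z<s k-small m≡u+d d-small))))

    strict-edge-bound : 2 * e W W + 9 * card W ≤ card W * card W
    strict-edge-bound = ≮⇒≥ λ excess → peeling (card W) W 0 ≤-refl (λ x∈ → x∈) (sym (+-identityʳ _)) z≤n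
      (subst (_< 2 * e W W + 9 * card W)
        (sym (trans (cong (card W * card W +_) (*-zeroʳ (suc (2 * t)))) (+-identityʳ _))) excess)


-- Goodman's inequality for triples and the final inequality.

hue : Bool → Bool → Bool
hue true  a = a
hue false a = not a

hue-true : ∀ β {a} → hue β a ≡ true → a ≡ β
hue-true true  {true}  _ = refl
hue-true false {false} _ = refl

other-hue : ∀ β {a} → hue β a ≡ false → hue (not β) a ≡ true
other-hue true  {false} _ = refl
other-hue false {true}  _ = refl

single-sym : ∀ {n} (x y : Fin n) → single x y ≡ single y x
single-sym x y with x Fin.≟ y | y Fin.≟ x
... | yes _   | yes _   = refl
... | no  _   | no  _   = refl
... | yes x≡y | no  y≢x = ⊥-elim (y≢x (sym x≡y))
... | no  x≢y | yes y≡x = ⊥-elim (x≢y (sym y≡x))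

-- Goodman.  Among the three pairs of a triangle taken in cyclic order, a red one is followed by a blue
-- one exactly once, unless the triangle is monochromatic.  The bits d, d′, d″ mark coinciding vertices.
goodman-triple : ∀ d d′ d″ a b c →
  let R = λ d a → ι (not d ∧ a)
      B = λ d a → ι (not d ∧ not a)
  in (R d a + B d a) * (R d′ b + B d′ b) ≤
     R d a * (R d′ b * R d″ c) + B d a * (B d′ b * B d″ c)
     + (R d a * B d′ b + R d″ c * B d a + R d′ b * B d″ c) + ι d″ * (R d a + B d a)
goodman-triple true  d′    d″    a     b     c     = z≤n
goodman-triple false true  d″    true  b     c     = z≤n
goodman-triple false true  d″    false b     c     = z≤n
goodman-triple false false true  true  true  c     = ≤-refl
goodman-triple false false true  true  false c     = s≤s z≤n
goodman-triple false false true  false true  c     = ≤-refl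
goodman-triple false false true  false false c     = ≤-refl
goodman-triple false false false true  true  true  = ≤-refl
goodman-triple false false false true  true  false = ≤-refl
goodman-triple false false false true  false true  = ≤-refl
goodman-triple false false false true  false false = ≤-refl
goodman-triple false false false false true  true  = ≤-refl
goodman-triple false false false false true  false = ≤-refl
goodman-triple false false false false false true  = ≤-refl
goodman-triple false false false false false false = ≤-refl

∑-rotate : ∀ {n} (F : Fin n → Fin n → Fin n → ℕ) →
           ∑ (λ v → ∑ λ x → ∑ λ y → F x y v) ≡ ∑ (λ v → ∑ λ x → ∑ λ y → F v x y)
∑-rotate F = trans (∑-swap λ v x → ∑ λ y → F x y v) (∑-cong λ x → ∑-swap λ v y → F x y v)

∑³-+ : ∀ {n} (F G : Fin n → Fin n → Fin n → ℕ) → ∑ (λ v → ∑ λ x → ∑ λ y → F v x y + G v x y) ≡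
       ∑ (λ v → ∑ λ x → ∑ λ y → F v x y) + ∑ (λ v → ∑ λ x → ∑ λ y → G v x y)
∑³-+ F G = trans (∑-cong λ v → trans (∑-cong λ x → ∑-+ (F v x) (G v x)) (∑-+ (λ x → ∑ (F v x)) (λ x → ∑ (G v x))))
                 (∑-+ (λ v → ∑ λ x → ∑ (F v x)) (λ v → ∑ λ x → ∑ (G v x)))

∑-product : ∀ {m n} (f : Fin m → ℕ) (g : Fin n → ℕ) → ∑ (λ x → ∑ λ y → f x * g y) ≡ ∑ f * ∑ g
∑-product f g = trans (∑-cong λ x → sym (∑-*ˡ (f x) g)) (sym (∑-*ʳ (∑ g) f))

double-product : ∀ x y → 2 * (x * y) ≤ x * x + y * y
double-product x y with ≤-total x y
... | inj₁ x≤y with d , refl ← m≤n⇒∃[o]m+o≡n x≤y = ≤-trans (m≤m+n _ (d * d)) (≤-reflexive (identity x d))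
  where
  identity : ∀ x d → 2 * (x * (x + d)) + d * d ≡ x * x + (x + d) * (x + d)
  identity = solve-∀
... | inj₂ y≤x with d , refl ← m≤n⇒∃[o]m+o≡n y≤x = ≤-trans (m≤m+n _ (d * d)) (≤-reflexive (identity y d))
  where
  identity : ∀ y d → 2 * ((y + d) * y) + d * d ≡ (y + d) * (y + d) + y * y
  identity = solve-∀

-- The decisive case amounts to 5 r² - 12 r b + 8 b² > 0, from 24 r b ≤ 9 r² + 16 b².
final-count : ∀ {k r b eR eB} → b ≤ r → 5 * k ≤ r + b → 0 < r → 2 * eR + 9 * r ≤ r * r →
              2 * eB ≤ 2 * (k * b) + 4 * b ⊎ 2 * eB ≤ b * b + 4 * b →
              (r + b) * (r + b) ≤ eR + eB + 3 * (r * b) + (r + b) → ⊥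
final-count {k} {r} {b} {eR} {eB} b≤r 5k≤r+b 0<r hR hB goodman = <⇒≱ 0<r (bound hB)
  where
  bound : 2 * eB ≤ 2 * (k * b) + 4 * b ⊎ 2 * eB ≤ b * b + 4 * b → r ≤ 0
  bound (inj₂ hB) = farkas 0 (+-mono-≤ (+-mono-≤ hR hB) (+-mono-≤ (+-mono-≤ (*-monoʳ-≤ 2 goodman) (double-product r b)) (*-monoʳ-≤ 6 b≤r)))
    (identity r b eR eB)
    where
    identity : ∀ r b eR eB →
      0 + (2 * eR + 9 * r + 2 * eB + (2 * ((r + b) * (r + b)) + 2 * (r * b) + 6 * b)) ≡
      r + (r * r + (b * b + 4 * b) + (2 * (eR + eB + 3 * (r * b) + (r + b)) + (r * r + b * b) + 6 * r)) + 0
    identity = solve-∀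
  bound (inj₁ hB) = farkas (r * r + 9 * r)
    (+-mono-≤ (+-mono-≤ (*-monoʳ-≤ 10 hR) (*-monoʳ-≤ 10 hB))
      (+-mono-≤ (+-mono-≤ (*-monoʳ-≤ 20 goodman) (*-monoʳ-≤ (4 * b) 5k≤r+b))
                (+-mono-≤ (double-product (3 * r) (4 * b)) (*-monoʳ-≤ 60 b≤r))))
    (identity k r b eR eB)
    where
    identity : ∀ k r b eR eB →
      0 + (10 * (2 * eR + 9 * r) + 10 * (2 * eB) + (20 * ((r + b) * (r + b)) + 4 * b * (5 * k) + (2 * (3 * r * (4 * b)) + 60 * b))) ≡
      r + (10 * (r * r) + 10 * (2 * (k * b) + 4 * b) +
        (20 * (eR + eB + 3 * (r * b) + (r + b)) + 4 * b * (r + b) + (3 * r * (3 * r) + 4 * b * (4 * b) + 60 * r))) + (r * r + 9 * r)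
    identity = solve-∀

-- Wheels and neighbourhoods in a colouring.

module _ {N : ℕ} (c : Colouring N) where
  open Colouring c

  -- The values of `col` on the diagonal are arbitrary and have to be masked to make both graphs
  -- irreflexive.
  adj : Bool → Fin N → Fin N → Bool
  adj β x y = not (single x y) ∧ hue β (col x y)

  adj-sym : ∀ β x y → adj β x y ≡ adj β y x
  adj-sym β x y = cong₂ (λ d a → not d ∧ hue β a) (single-sym x y) (col-sym x y)

  adj-irrefl : ∀ β x → adj β x x ≡ false
  adj-irrefl β x rewrite single-refl x = refl

  adj⇒≢ : ∀ β {x y} → adj β x y ≡ true → x ≢ y
  adj⇒≢ β {x} x~x refl = true≢false x~x (adj-irrefl β x)

  adj⇒col : ∀ β {x y} → adj β x y ≡ true → col x y ≡ β
  adj⇒col β {x} {y} x~y with single x y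
  ... | false = hue-true β x~y

  adj-other : ∀ β {x y} → x ≢ y → adj β x y ≡ false → adj (not β) x y ≡ true
  adj-other β {x} {y} x≢y h rewrite single-false x≢y = other-hue β h

  module G (β : Bool) = Graphs (adj β) (adj-sym β) (adj-irrefl β)

  wheel-copy : ∀ β x k → G.Cycle β (adj β x) (suc k) → MonoCopy (Wheel (suc k)) c
  wheel-copy β x k C with p , P ← G.periodic β C = β , f , f-injective , f-colour
    where
    open G.Periodic β P
    f : Fin (2 + k) → Fin N
    f zero    = x
    f (suc i) = p (toℕ i)
    spoke : ∀ i → col x (p i) ≡ β
    spoke i = adj⇒col β (inside i)
    rim-edge : ∀ i → col (p (toℕ i)) (p (toℕ (next i))) ≡ β
    rim-edge i = trans
      (cong (col (p (toℕ i))) (trans (cong p (Fin.toℕ-fromℕ< (m%n<n (suc (toℕ i)) (suc k)))) (period-% (suc (toℕ i)))))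
      (adj⇒col β (step (toℕ i)))
    f-injective : ∀ {i j} → f i ≡ f j → i ≡ j
    f-injective {zero}  {zero}  _  = refl
    f-injective {zero}  {suc j} eq = ⊥-elim (adj⇒≢ β (inside (toℕ j)) eq)
    f-injective {suc i} {zero}  eq = ⊥-elim (adj⇒≢ β (inside (toℕ i)) (sym eq))
    f-injective {suc i} {suc j} eq with <-cmp (toℕ i) (toℕ j)
    ... | tri< i<j _ _ = ⊥-elim (inj-L i<j (Fin.toℕ<n j) eq)
    ... | tri≈ _ i≡j _ = cong suc (Fin.toℕ-injective i≡j)
    ... | tri> _ _ j<i = ⊥-elim (inj-L j<i (Fin.toℕ<n i) (sym eq))
    f-colour : ∀ y z → Graph.Adj (Wheel (suc k)) y z → col (f y) (f z) ≡ β
    f-colour _ _ (hub i)  = spoke (toℕ i)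
    f-colour _ _ (hub' i) = trans (col-sym (p (toℕ i)) x) (spoke (toℕ i))
    f-colour _ _ (rim i)  = rim-edge i
    f-colour _ _ (rim' i) = trans (col-sym (p (toℕ (next i))) (p (toℕ i))) (rim-edge i)

  -- Since this finite search is decidable, refuting the absence of wheels produces an actual copy.
  wheel? : ∀ k → Dec (∃ λ β → ∃ λ x → G.Cycle β (adj β x) (suc k))
  wheel? k with Fin.any? (λ x → G.cycle? true (adj true x) k) | Fin.any? (λ x → G.cycle? false (adj false x) k)
  ... | yes red | _        = yes (true , red)
  ... | no  _   | yes blue = yes (false , blue)
  ... | no  ¬red | no ¬blue = no λ { (true , red) → ¬red red ; (false , blue) → ¬blue blue }

  nbd-size : Bool → Fin N → ℕ
  nbd-size β x = ∑ (λ y → ι (adj β x y))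

  nbd-edges : Bool → Fin N → ℕ
  nbd-edges β x = G.e β (adj β x) (adj β x)

  nbd-sizes : ∀ x → N ≡ suc (nbd-size true x + nbd-size false x)
  nbd-sizes x = begin
    N                                                             ≡⟨ *-identityʳ N ⟨
    N * 1                                                         ≡⟨ ∑-const N 1 ⟨
    ∑ (λ y → 1)                                                   ≡⟨ ∑-cong (λ y → partition (single x y) (col x y)) ⟩
    ∑ (λ y → ι (single x y) + (ι (adj true x y) + ι (adj false x y)))
      ≡⟨ trans (∑-+ (λ y → ι (single x y)) _) (cong (∑ (λ y → ι (single x y)) +_) (∑-+ (λ y → ι (adj true x y)) _)) ⟩
    ∑ (λ y → ι (single x y)) + (nbd-size true x + nbd-size false x)
      ≡⟨ cong (_+ (nbd-size true x + nbd-size false x)) (G.card-single true x) ⟩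
    suc (nbd-size true x + nbd-size false x) ∎
    where
    open ≡-Reasoning
    partition : ∀ d a → 1 ≡ ι d + (ι (not d ∧ a) + ι (not d ∧ not a))
    partition true  a     = refl
    partition false true  = refl
    partition false false = refl

  -- A β-independent set of size k + 1 in a β-neighbourhood spans a wheel of the other colour.
  nbd-independence : ∀ k → (∀ β x → ¬ G.Cycle β (adj β x) (2 + k)) → ∀ β x → G.Independence≤ β (2 + k) (adj β x)
  nbd-independence k no-wheel β x I I⊆ indep = ≮⇒≥ λ k<I →
    case G.card-positive β {I} (≤-<-trans z≤n k<I) of λ (y , y∈I) →
      no-wheel (not β) y (G.cycle-mono (not β)
        (λ z∈ → clique y∈I (∈I z∈) λ { refl → true≢false (single-refl y) (G.∖-∉ β {I} {single y} z∈) })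
        (G.clique-cycle (not β) (λ a∈ b∈ → clique (∈I a∈) (∈I b∈)) k
          (s≤s⁻¹ (≤-trans k<I (≤-reflexive (G.card-remove β {I} y∈I))))))
    where
    clique : ∀ {a b} → I a ≡ true → I b ≡ true → a ≢ b → adj (not β) a b ≡ true
    clique a∈ b∈ a≢b = adj-other β a≢b (indep a∈ b∈)
    ∈I : ∀ {y z} → G._∖_ β I (single y) z ≡ true → I z ≡ true
    ∈I {y} = G.∖-⊆ β {I} {single y}

  -- `goodman-triple` is summed over all ordered triples. `M` counts the monochromatic triangles,
  -- that is the edges inside the neighbourhoods; the three cyclic shifts of `F` have equal sums,
  -- whence the factor 3; and `S` collects the triples with x = y. An inequality between sums over
  -- `v` holds for some `v`.
  goodman : 0 < N → ∃ λ v →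
            (nbd-size true v + nbd-size false v) * (nbd-size true v + nbd-size false v) ≤
            nbd-edges true v + nbd-edges false v + 3 * (nbd-size true v * nbd-size false v) +
            (nbd-size true v + nbd-size false v)
  goodman 0<N = ∑-pigeonhole 0<N H′ H (begin
    ∑ (λ v → D v * D v)
      ≡⟨ ∑-cong (λ v → trans (cong (λ d → d * d) (sym (∑-+ (R v) (B v)))) (sym (∑-product (λ x → R v x + B v x) (λ y → R v y + B v y)))) ⟩
    ∑ (λ v → ∑ λ x → ∑ λ y → (R v x + B v x) * (R v y + B v y))
      ≤⟨ ∑-mono (λ v → ∑-mono λ x → ∑-mono λ y → triple v x y) ⟩
    ∑³ (λ v x y → M v x y + (F v x y + F x y v + F y v x) + S v x y)
      ≡⟨ trans (∑³-+ (λ v x y → M v x y + (F v x y + F x y v + F y v x)) S) (cong (_+ ∑³ S)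
           (trans (∑³-+ M (λ v x y → F v x y + F x y v + F y v x)) (cong (∑³ M +_)
             (trans (∑³-+ (λ v x y → F v x y + F x y v) (λ v x y → F y v x))
               (cong (_+ ∑³ (λ v x y → F y v x)) (∑³-+ F (λ v x y → F x y v))))))) ⟩
    ∑³ M + (∑³ F + ∑³ (λ v x y → F x y v) + ∑³ (λ v x y → F y v x)) + ∑³ S
      ≡⟨ cong₂ (λ a b → ∑³ M + (∑³ F + a + b) + ∑³ S) (∑-rotate F)
           (trans (∑-rotate (λ v x y → F x y v)) (∑-rotate F)) ⟩
    ∑³ M + (∑³ F + ∑³ F + ∑³ F) + ∑³ S
      ≡⟨ regroup (∑³ M) (∑³ F) (∑³ S) ⟩
    ∑³ M + 3 * ∑³ F + ∑³ S
      ≡⟨ cong₂ _+_ (cong₂ _+_ M-sum (trans (∑-*ˡ 3 (λ v → ∑ λ x → ∑ λ y → F v x y)) (∑-cong λ v → cong (3 *_) (∑-product (R v) (B v))))) S-sum ⟩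
    ∑ (λ v → nbd-edges true v + nbd-edges false v) + ∑ (λ v → 3 * (nbd-size true v * nbd-size false v)) + ∑ D
      ≡⟨ trans (cong (_+ ∑ D) (sym (∑-+ (λ v → nbd-edges true v + nbd-edges false v) (λ v → 3 * (nbd-size true v * nbd-size false v)))))
           (sym (∑-+ (λ v → nbd-edges true v + nbd-edges false v + 3 * (nbd-size true v * nbd-size false v)) D)) ⟩
    ∑ H ∎)
    where
    open ≤-Reasoning
    ∑³ : (Fin N → Fin N → Fin N → ℕ) → ℕ
    ∑³ F = ∑ λ v → ∑ λ x → ∑ λ y → F v x y
    R B : Fin N → Fin N → ℕ
    R x y = ι (adj true x y)
    B x y = ι (adj false x y)
    D H H′ : Fin N → ℕ
    D v  = nbd-size true v + nbd-size false v
    H′ v = D v * D v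
    H v  = nbd-edges true v + nbd-edges false v + 3 * (nbd-size true v * nbd-size false v) + D v
    M F S : Fin N → Fin N → Fin N → ℕ
    M v x y = R v x * (R v y * R x y) + B v x * (B v y * B x y)
    F v x y = R v x * B v y
    S v x y = ι (single x y) * (R v x + B v x)
    triple : ∀ v x y → (R v x + B v x) * (R v y + B v y) ≤ M v x y + (F v x y + F x y v + F y v x) + S v x y
    triple v x y rewrite adj-sym false x v | adj-sym true y v | adj-sym false y x =
      goodman-triple (single v x) (single v y) (single x y) (col v x) (col v y) (col x y)
    regroup : ∀ m f s → m + (f + f + f) + s ≡ m + 3 * f + s
    regroup = solve-∀
    M-sum : ∑³ M ≡ ∑ (λ v → nbd-edges true v + nbd-edges false v)
    M-sum = ∑-cong λ v → trans (∑-cong λ x → ∑-+ (λ y → R v x * (R v y * R x y)) (λ y → B v x * (B v y * B x y)))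
      (trans (∑-+ (λ x → ∑ λ y → R v x * (R v y * R x y)) (λ x → ∑ λ y → B v x * (B v y * B x y)))
        (cong₂ _+_ (∑-cong λ x → sym (∑-*ˡ (R v x) (λ y → R v y * R x y)))
                   (∑-cong λ x → sym (∑-*ˡ (B v x) (λ y → B v y * B x y)))))
    S-sum : ∑³ S ≡ ∑ D
    S-sum = ∑-cong λ v → trans (∑-cong λ x → ∑-single x (λ y → R v x + B v x)) (∑-+ (R v) (B v))

  no-wheel-impossible : ∀ i → N ≡ 10 * suc i + 4000 → (∀ β x → ¬ G.Cycle β (adj β x) (3 + 2 * i)) → ⊥
  no-wheel-impossible i N≡ no-wheel with goodman (subst (0 <_) (sym N≡) z<s)
  ... | v , count = by-majority (≤-total (nbd-size false v) (nbd-size true v))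
    where
    r b : ℕ
    r = nbd-size true v
    b = nbd-size false v
    -- With k = 3 + 2 i, the N - 1 = 10 i + 4009 other vertices number 5 k + 3994.
    total : 5 * (3 + 2 * i) + 3994 ≡ r + b
    total = suc-injective (trans (sym (trans N≡ (identity i))) (nbd-sizes v))
      where
      identity : ∀ i → 10 * suc i + 4000 ≡ suc (5 * (3 + 2 * i) + 3994)
      identity = solve-∀
    larger : ∀ x y → 5 * (3 + 2 * i) + 3994 ≡ x + y → y ≤ x → 5 * (3 + 2 * i) + 3994 ≤ 2 * x
    larger x y eq y≤x = ≤-trans (≤-reflexive eq) (+-monoʳ-≤ x (≤-trans y≤x (≤-reflexive (sym (+-identityʳ x)))))
    strict : ∀ β → 5 * (3 + 2 * i) + 3994 ≤ 2 * nbd-size β v →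
             2 * nbd-edges β v + 9 * nbd-size β v ≤ nbd-size β v * nbd-size β v
    strict β large = G.strict-edge-bound β i 63 ≤-refl (adj β v) (no-wheel β v)
      (nbd-independence (suc (2 * i)) no-wheel β v) (≤-trans (m≤m+n (5 * (3 + 2 * i)) 3994) large)
      (enough (nbd-size β v) (≤-trans (m≤n+m 3994 (5 * (3 + 2 * i))) large))
      where
      -- The left side for T = 64 is 9 · 1960, and the hypothesis gives m ≥ 1997.
      enough : ∀ m → 3994 ≤ 2 * m → 10 * (27 * 64 + 35) + 10 ≤ 9 * m
      enough m h = *-cancelˡ-≤ 2 (≤-trans (≤ᵇ⇒≤ (2 * (10 * (27 * 64 + 35) + 10)) (9 * 3994) _)
        (≤-trans (*-monoʳ-≤ 9 h) (≤-reflexive (swap m))))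
        where
        swap : ∀ m → 9 * (2 * m) ≡ 2 * (9 * m)
        swap = solve-∀
    weak : ∀ β → G.EdgeBound β (3 + 2 * i) (adj β v)
    weak β = G.edge-bound β (2 * i) (nbd-size β v) (adj β v) ≤-refl (no-wheel β v)
    positive : ∀ x → 5 * (3 + 2 * i) + 3994 ≤ 2 * x → 0 < x
    positive zero h = case ≤-trans (m≤n+m 3994 (5 * (3 + 2 * i))) h of λ ()
    positive (suc _) _ = z<s
    by-majority : b ≤ r ⊎ r ≤ b → ⊥
    by-majority (inj₁ b≤r) = final-count {3 + 2 * i} {r} {b} {nbd-edges true v} {nbd-edges false v} b≤r (≤-trans (m≤m+n (5 * (3 + 2 * i)) 3994) (≤-reflexive total))
      (positive r (larger r b total b≤r)) (strict true (larger r b total b≤r)) (weak false) count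
    by-majority (inj₂ r≤b) = final-count {3 + 2 * i} {b} {r} {nbd-edges false v} {nbd-edges true v} r≤b (≤-trans (m≤m+n (5 * (3 + 2 * i)) 3994) (≤-reflexive total′))
      (positive b (larger b r total′ r≤b)) (strict false (larger b r total′ r≤b)) (weak true)
      (subst₂ _≤_ (cong (λ m → m * m) (+-comm r b)) (swap r b (nbd-edges true v) (nbd-edges false v)) count)
      where
      total′ : 5 * (3 + 2 * i) + 3994 ≡ b + r
      total′ = trans total (+-comm r b)
      swap : ∀ r b x y → x + y + 3 * (r * b) + (r + b) ≡ y + x + 3 * (b * r) + (b + r)
      swap = solve-∀

theorem1p11 : Σ ℕ λ c → (0 < c) ×
                  ((n : ℕ) → 0 < n → RamseyLe (Wheel (2 * n + 1)) (10 * n + c))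
theorem1p11 = 4000 , z<s , arrows
  where
  arrows : (n : ℕ) → 0 < n → RamseyLe (Wheel (2 * n + 1)) (10 * n + 4000)
  arrows (suc i) _ c with wheel? c (2 + 2 * i)
  ... | yes (β , x , C) = subst (λ k → MonoCopy (Wheel k) c) (odd i) (wheel-copy c β x (2 + 2 * i) C)
    where
    odd : ∀ i → 3 + 2 * i ≡ 2 * suc i + 1
    odd = solve-∀
  ... | no none = ⊥-elim (no-wheel-impossible c i refl λ β x C → none (β , x , C))
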